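{- Let $H_1,\ldots,H_n$ be complete multipartite graphs such that $\beta(H_1)\leq\cdots\leq\beta(H_n)$ and \[\prod_{k\in A}\frac{1-\beta(H_k)}{\beta(H_k)}\geq \frac{1-\beta(H_n)}{\beta(H_n)}\] for all nonempty $A\subseteq[n-1]$. Then \[\Phi(H_1,\nu)=\begin{cases}0,&\nu=0;\\ 1-\beta(H_1),&0<\nu\leq\beta(H_1);\\ 1,&\beta(H_1)<\nu\leq 1,\end{cases}\] and if $n\geq 2$, then \[\Phi(H_1\times\cdots\times H_n,\nu)=\begin{cases}0,&\nu=0;\\ (1-\beta(H_n))\,\Phi\!\left(H_1\times\cdots\times H_{n-1},\dfrac{\nu}{\beta(H_n)}\right),&0<\nu\leq\beta(H_n);\\ 1-\beta(H_n)+\beta(H_n)\,\Phi\!\left(H_1\times\cdots\times H_{n-1},\dfrac{\nu-\beta(H_n)}{1-\beta(H_n)}\right),&\beta(H_n)<\nu\leq 1.\end{cases}\]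
   Context: All graphs are simple and finite. The direct product $H_1\times\cdots\times H_n$ has vertex set $V(H_1)\times\cdots\times V(H_n)$, with two vertices adjacent iff they are adjacent in every coordinate. For a graph $G$, $\beta(G)=\alpha(G)/|V(G)|$, where $\alpha(G)$ is the independence number. $\mu$ denotes the uniform probability measure on $V(G)$, $\mu(S)=|S|/|V(G)|$. For $S\subseteq V(G)$, the vertex boundary is $\partial S=\{w\in V(G):\{v,w\}\in E(G)\text{ for some }v\in S\}$. The vertex isoperimetric profile is $\Phi(G,\nu)=\min\{\mu(\partial S):S\subseteq V(G),\ \mu(S)\geq\nu\}$ for $\nu\in[0,1]$.
   Formalization: The parameter ν ranges over the rational numbers in [0,1] rather than over all real numbers in [0,1]. -}

module Defs where

open import Data.Bool using (Bool; true; false; _∧_; not; if_then_else_)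
open import Data.Nat as ℕ using (ℕ; zero; suc; NonZero)
open import Data.Nat.Properties using (m*n≢0)
open import Data.Fin as Fin using (Fin; zero; suc; remQuot; inject₁; fromℕ)
open import Data.Fin.Subset using (Subset; ∣_∣; Nonempty)
open import Data.Vec using (Vec; []; _∷_; lookup; tabulate)
open import Data.List as List using (List; []; _∷_; _++_; map; foldr; allFin)
open import Data.Bool.ListAction using (all; any)
open import Data.Maybe using (Maybe; just; nothing; maybe)
open import Data.Product using (Σ; _×_; _,_; proj₁; proj₂)
open import Data.Integer using (+_)
open import Data.Rational as ℚ using (ℚ; 0ℚ; 1ℚ; _÷_; _⊓_; _≤ᵇ_; _-_; _*_; _+_; _≤_; _<_; ≢-nonZero)
open import Data.Rational.Properties using (_≟_)
open import Relation.Nullary using (¬_; yes; no)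
open import Relation.Binary.PropositionalEquality using (_≡_; _≢_; refl; cong₂)

-- Finite simple graphs with a NONEMPTY vertex set Fin V
-- (nonemptiness is needed for μ and β to be defined).

record Graph : Set where
  field
    V      : ℕ
    {{nz}} : NonZero V
    adj    : Fin V → Fin V → Bool
    sym    : ∀ u v → adj u v ≡ adj v u
    irrefl : ∀ u → adj u u ≡ false
open Graph public

CompleteMultipartite : Graph → Set
CompleteMultipartite G =
  Σ ℕ λ k → Σ (Fin (V G) → Fin k) λ p →
    ∀ u v → (adj G u v ≡ true → p u ≢ p v) × (p u ≢ p v → adj G u v ≡ true)

private
  ∧-false : ∀ b → (false ∧ b) ≡ false
  ∧-false b = refl

_×G_ : Graph → Graph → Graph
G ×G H = record
  { V      = V G ℕ.* V H
  ; nz     = m*n≢0 (V G) (V H) {{nz G}} {{nz H}}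
  ; adj    = a
  ; sym    = s
  ; irrefl = i
  }
  where
  rq : Fin (V G ℕ.* V H) → Fin (V G) × Fin (V H)
  rq = remQuot {V G} (V H)
  a : Fin (V G ℕ.* V H) → Fin (V G ℕ.* V H) → Bool
  a x y = adj G (proj₁ (rq x)) (proj₁ (rq y))
        ∧ adj H (proj₂ (rq x)) (proj₂ (rq y))
  s : ∀ x y → a x y ≡ a y x
  s x y = cong₂ _∧_ (sym G (proj₁ (rq x)) (proj₁ (rq y)))
                    (sym H (proj₂ (rq x)) (proj₂ (rq y)))
  i : ∀ x → a x x ≡ false
  i x with adj G (proj₁ (rq x)) (proj₁ (rq x))
         | irrefl G (proj₁ (rq x))
  ... | .false | refl = refl

-- H₀ × H₁ × ⋯ × Hₘ  (indices 0..m, i.e. the paper's H_1,…,H_{m+1}),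
-- built as ((H₀ × H₁) × ⋯) × Hₘ.
prodG : (m : ℕ) → (Fin (suc m) → Graph) → Graph
prodG zero    H = H zero
prodG (suc m) H = prodG m (λ i → H (inject₁ i)) ×G H (fromℕ (suc m))

allSubsets : (n : ℕ) → List (Subset n)
allSubsets zero    = [] ∷ []
allSubsets (suc n) = map (true ∷_) (allSubsets n) ++ map (false ∷_) (allSubsets n)

isIndependent : (G : Graph) → Subset (V G) → Bool
isIndependent G S =
  all (λ u → all (λ v → not (lookup S u ∧ lookup S v ∧ adj G u v)) (allFin (V G))) (allFin (V G))

α : Graph → ℕ
α G = foldr ℕ._⊔_ 0
        (map (λ S → if isIndependent G S then ∣ S ∣ else 0) (allSubsets (V G)))

β : Graph → ℚ
β G = (+ α G) ℚ./ V G
  where instance _ = nz G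

μ : (G : Graph) → Subset (V G) → ℚ
μ G S = (+ ∣ S ∣) ℚ./ V G
  where instance _ = nz G

∂ : (G : Graph) → Subset (V G) → Subset (V G)
∂ G S = tabulate (λ w → any (λ v → lookup S v ∧ adj G v w) (allFin (V G)))

-- Φ(G,ν) = min { μ(∂S) : μ(S) ≥ ν }.  The set is nonempty for ν ≤ 1
-- (take S = V(G)); the fallback value 1 is only used when ν > 1.
Φ : Graph → ℚ → ℚ
Φ G ν = maybe (λ x → x) 1ℚ (foldr step nothing (allSubsets (V G)))
  where
  step : Subset (V G) → Maybe ℚ → Maybe ℚ
  step S acc = if ν ≤ᵇ μ G S
               then just (maybe (λ m → μ G (∂ G S) ⊓ m) (μ G (∂ G S)) acc)
               else acc

-- Total division on ℚ (p / 0 := 0); only ever applied to nonzero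
-- denominators in the theorem.
_÷'_ : ℚ → ℚ → ℚ
p ÷' q with q ≟ 0ℚ
... | yes _  = 0ℚ
... | no q≢0 = _÷_ p q {{≢-nonZero q≢0}}

ρ : Graph → ℚ
ρ H = (1ℚ - β H) ÷' β H

prodOver : {m : ℕ} → Subset m → (Fin m → ℚ) → ℚ
prodOver {m} A f = foldr (λ k acc → if lookup A k then f k * acc else acc) 1ℚ (allFin m)

FirstClaim : Graph → Set
FirstClaim H = ∀ (ν : ℚ) → 0ℚ ≤ ν → ν ≤ 1ℚ →
    (ν ≡ 0ℚ → Φ H ν ≡ 0ℚ)
  × (0ℚ < ν → ν ≤ β H → Φ H ν ≡ 1ℚ - β H)
  × (β H < ν → Φ H ν ≡ 1ℚ)

SecondClaim : (m : ℕ) → (Fin (suc m) → Graph) → Set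
SecondClaim zero    H = Data.Unit.⊤
  where import Data.Unit
SecondClaim (suc m) H = ∀ (ν : ℚ) → 0ℚ ≤ ν → ν ≤ 1ℚ →
    (ν ≡ 0ℚ → Φ (prodG (suc m) H) ν ≡ 0ℚ)
  × (0ℚ < ν → ν ≤ βₙ →
       Φ (prodG (suc m) H) ν ≡ (1ℚ - βₙ) * Φ (prodG m H′) (ν ÷' βₙ))
  × (βₙ < ν →
       Φ (prodG (suc m) H) ν ≡ (1ℚ - βₙ) + βₙ * Φ (prodG m H′) ((ν - βₙ) ÷' (1ℚ - βₙ)))
  where
  βₙ = β (H (fromℕ (suc m)))
  H′ : Fin (suc m) → Graph
  H′ i = H (inject₁ i)

{-# OPTIONS --safe #-}
module Submission where

-- Up to taking better sets, only whether each coordinate of a vertex lies in the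
-- largest part of its factor matters: the sections of S over the last factor
-- can be replaced by the points meeting some section (over the largest part) and
-- the points lying over an edge of the factor (over the rest), which lowers the
-- boundary and not the size.  So S becomes an up-set F of the cube {0,1}ⁿ with the
-- product measure in which coordinate i is 1 with probability βᵢ, and since two
-- cube points are adjacent iff their supports are disjoint, ∂F consists of the
-- complements of the points of F: its measure is the measure of F with every
-- βᵢ replaced by 1 - βᵢ.
--
-- Replacing x by (x ∖ A) ∪ {n}, for n ∉ x ⊇ A ≠ ∅, multiplies the first measure by
-- ∏_A ρ / ρₙ ≥ 1 and the second by its inverse.  Applying such a shift
-- wherever the target is missing, with A minimal so that F remains an up-set,
-- ends with F either inside or containing {x : xₙ = 1}; these are the two cases
-- of the recursion.

open import Defs
open import Data.Bool as Bool using (Bool; true; false; _∧_; _∨_; not; T; if_then_else_)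
open import Data.Bool.ListAction using (any; all)
import Data.Bool.Properties as Boolₚ
open import Data.Fin as Fin using (Fin; zero; suc; inject₁; fromℕ; remQuot; combine; _↑ˡ_; _↑ʳ_)
import Data.Fin.Properties as Finₚ
open import Data.Fin.Subset as Subset using (Subset; Nonempty; ∣_∣; _∩_; _∪_)
import Data.Fin.Subset.Properties as Subsetₚ
open import Data.List as List using (List; []; _∷_; map; foldr; allFin)
import Data.List.Properties as Listₚ
open import Data.List.Membership.Propositional using (_∈_; lose)
open import Data.List.Membership.Propositional.Properties
  using (∈-allFin; ∈-map⁺; ∈-map⁻; ∈-++⁺ˡ; ∈-++⁺ʳ; foldr-selective)
import Data.List.Relation.Unary.All as All
open import Data.List.Relation.Unary.All.Properties using (all⁺; all⁻)
open import Data.List.Relation.Unary.Any using (here; there; satisfied)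
open import Data.List.Relation.Unary.Any.Properties using (any⁺; any⁻)
open import Data.Maybe using (Maybe; just; nothing; maybe)
open import Data.Maybe.Properties using (just-injective)
open import Data.Nat as ℕ using (ℕ; zero; suc; _∸_; z≤n; NonZero)
import Data.Nat.Coprimality as Coprimality
open import Data.Nat.Induction using (Acc; acc; <-wellFounded)
import Data.Nat.Properties as ℕₚ
open import Data.Nat.Tactic.RingSolver using (solve-∀)
open import Data.Product using (∃; _×_; _,_; proj₁; proj₂; swap)
open import Data.Sum using (_⊎_; inj₁; inj₂)
open import Data.Unit using (tt)
open import Data.Vec as Vec using (Vec; []; _∷_; lookup; tabulate; replicate; zipWith; _∷ʳ_)
import Data.Vec.Properties as Vecₚ
open import Data.Vec.Relation.Binary.Pointwise.Inductive as Pointwise using (Pointwise; []; _∷_)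
open import Function using (_∘_; const; Equivalence)
open import Relation.Binary.PropositionalEquality as ≡ using (_≡_; _≢_; refl; cong; cong₂; subst; subst₂)
open import Relation.Nullary using (¬_; yes; no; does; contradiction; _×-dec_)
open import Relation.Unary using (Decidable)

-- Weighted cubes, their up-sets and compression

module WeightedCube where

  open import Data.Nat using (_+_; _*_; _≤_; _<_)
  open import Data.Nat.Properties
  open ℕₚ.≤-Reasoning

  not-true⇒false : ∀ {b} → b ≢ true → b ≡ false
  not-true⇒false {false} _ = refl
  not-true⇒false {true} h = contradiction refl h

  ∧-true : ∀ {a b} → a ∧ b ≡ true → a ≡ true × b ≡ true
  ∧-true {true} {true} _ = refl , refl

  -- Indicators and weighted sums over the cube

  𝟙 : Bool → ℕ
  𝟙 true  = 1
  𝟙 false = 0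

  𝟙-mono : ∀ {b c} → (b ≡ true → c ≡ true) → 𝟙 b ≤ 𝟙 c
  𝟙-mono {false} h = z≤n
  𝟙-mono {true}  h rewrite h refl = ≤-refl

  𝟙-split : ∀ {b c} → (c ≡ true → b ≡ true) → 𝟙 b ≡ 𝟙 (b ∧ not c) + 𝟙 c
  𝟙-split {true}  {true}  h = refl
  𝟙-split {true}  {false} h = refl
  𝟙-split {false} {false} h = refl
  𝟙-split {false} {true}  h with () ← h refl

  𝟙-join : ∀ {b c} → (c ≡ true → b ≡ false) → 𝟙 (b ∨ c) ≡ 𝟙 b + 𝟙 c
  𝟙-join {true}  {true}  h with () ← h refl
  𝟙-join {true}  {false} h = refl
  𝟙-join {false} {c}     h = refl

  Cube : ℕ → Set
  Cube = Vec Bool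

  -- A coordinate of weight (a , c) contributes the factor a when it is 1 and c
  -- when it is 0.
  Weights : ℕ → Set
  Weights = Vec (ℕ × ℕ)

  W : ∀ {n} → Weights n → (Cube n → ℕ) → ℕ
  W []             f = f []
  W ((a , c) ∷ ws) f = a * W ws (f ∘ (true ∷_)) + c * W ws (f ∘ (false ∷_))

  dual : ∀ {n} → Weights n → Weights n
  dual = Vec.map swap

  dual-involutive : ∀ {n} (ws : Weights n) → dual (dual ws) ≡ ws
  dual-involutive []       = refl
  dual-involutive (w ∷ ws) = cong (w ∷_) (dual-involutive ws)

  W-mono : ∀ {n} (ws : Weights n) {f g} → (∀ x → f x ≤ g x) → W ws f ≤ W ws g
  W-mono []             h = h []
  W-mono ((a , c) ∷ ws) h =
    +-mono-≤ (*-monoʳ-≤ a (W-mono ws (h ∘ (true ∷_)))) (*-monoʳ-≤ c (W-mono ws (h ∘ (false ∷_))))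

  W-cong : ∀ {n} (ws : Weights n) {f g} → (∀ x → f x ≡ g x) → W ws f ≡ W ws g
  W-cong ws h = ≤-antisym (W-mono ws (≤-reflexive ∘ h)) (W-mono ws (≤-reflexive ∘ ≡.sym ∘ h))

  W-zero : ∀ {n} (ws : Weights n) → W ws (const 0) ≡ 0
  W-zero []             = refl
  W-zero ((a , c) ∷ ws) rewrite W-zero ws | *-zeroʳ a | *-zeroʳ c = refl

  W-+ : ∀ {n} (ws : Weights n) (f g : Cube n → ℕ) → W ws (λ x → f x + g x) ≡ W ws f + W ws g
  W-+ []             f g = refl
  W-+ ((a , c) ∷ ws) f g
    rewrite W-+ ws (f ∘ (true ∷_)) (g ∘ (true ∷_)) | W-+ ws (f ∘ (false ∷_)) (g ∘ (false ∷_)) =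
    interchange a c _ _ _ _
    where
    interchange : ∀ a c p q r s → a * (p + q) + c * (r + s) ≡ (a * p + c * r) + (a * q + c * s)
    interchange = solve-∀

  -- Complementing a coordinate exchanges its two factors, so the measure of a set of complements
  -- becomes a dual measure.
  W-dual : ∀ {n} (ws : Weights n) (f : Cube n → ℕ) → W ws (f ∘ Vec.map not) ≡ W (dual ws) f
  W-dual []             f = refl
  W-dual ((a , c) ∷ ws) f
    rewrite W-dual ws (f ∘ (false ∷_)) | W-dual ws (f ∘ (true ∷_)) = +-comm (a * _) (c * _)

  -- Under these weights `W` counts points, which gives compression a quantity that drops at every
  -- shift.
  units : ∀ n → Weights n
  units n = replicate n (1 , 1)

  W-point : ∀ {n} (f : Cube n → ℕ) x → f x ≤ W (units n) f
  W-point f []          = ≤-refl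
  W-point {suc n} f (true ∷ x)  =
    ≤-trans (W-point (f ∘ (true ∷_)) x)
      (≤-trans (m≤m+n _ 0) (m≤m+n (1 * W (units n) (f ∘ (true ∷_))) _))
  W-point {suc n} f (false ∷ x) =
    ≤-trans (W-point (f ∘ (false ∷_)) x)
      (≤-trans (m≤m+n _ 0) (m≤n+m _ (1 * W (units n) (f ∘ (true ∷_)))))

  -- The order of the cube and its up-sets

  infix 4 _⊑_

  _⊑_ : ∀ {n} → Cube n → Cube n → Set
  _⊑_ = Pointwise Bool._≤_

  ⊑-refl : ∀ {n} {x : Cube n} → x ⊑ x
  ⊑-refl = Pointwise.refl Boolₚ.≤-refl

  ⊑-zipWith : ∀ {n} {f g : Bool → Bool → Bool} → (∀ a b → f a b Bool.≤ g a b) →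
              (x y : Cube n) → zipWith f x y ⊑ zipWith g x y
  ⊑-zipWith h []      []      = []
  ⊑-zipWith h (a ∷ x) (b ∷ y) = h a b ∷ ⊑-zipWith h x y

  infixl 7 _∖_

  _∖_ : ∀ {n} → Cube n → Cube n → Cube n
  _∖_ = zipWith (λ a b → a ∧ not b)

  IsUp : ∀ {n} → (Cube n → Bool) → Set
  IsUp F = ∀ {x y} → x ⊑ y → F x ≡ true → F y ≡ true

  contains disjoint : ∀ {n} → Cube n → Cube n → Bool
  contains []          []      = true
  contains (true ∷ A)  (b ∷ x) = b ∧ contains A x
  contains (false ∷ A) (b ∷ x) = contains A x
  disjoint []          []      = true
  disjoint (true ∷ A)  (b ∷ x) = not b ∧ disjoint A x
  disjoint (false ∷ A) (b ∷ x) = disjoint A x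

  ∖-∪-⊑ : ∀ {n} (A x : Cube n) → contains A x ≡ true → x ∖ A ∪ A ⊑ x
  ∖-∪-⊑ []          []          h = []
  ∖-∪-⊑ (true ∷ A)  (true ∷ x)  h = Bool.b≤b ∷ ∖-∪-⊑ A x h
  ∖-∪-⊑ (false ∷ A) (true ∷ x)  h = Bool.b≤b ∷ ∖-∪-⊑ A x h
  ∖-∪-⊑ (false ∷ A) (false ∷ x) h = Bool.b≤b ∷ ∖-∪-⊑ A x h

  ⊑-∖-∪ : ∀ {n} (A x : Cube n) → x ⊑ x ∖ A ∪ A
  ⊑-∖-∪ []          []          = []
  ⊑-∖-∪ (true ∷ A)  (true ∷ x)  = Bool.b≤b ∷ ⊑-∖-∪ A x
  ⊑-∖-∪ (true ∷ A)  (false ∷ x) = Bool.f≤t ∷ ⊑-∖-∪ A x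
  ⊑-∖-∪ (false ∷ A) (true ∷ x)  = Bool.b≤b ∷ ⊑-∖-∪ A x
  ⊑-∖-∪ (false ∷ A) (false ∷ x) = Bool.b≤b ∷ ⊑-∖-∪ A x

  ∪-∖-∖-⊑ : ∀ {n} (A x : Cube n) → (x ∪ A) ∖ (A ∖ x) ⊑ x
  ∪-∖-∖-⊑ []          []          = []
  ∪-∖-∖-⊑ (true ∷ A)  (true ∷ x)  = Bool.b≤b ∷ ∪-∖-∖-⊑ A x
  ∪-∖-∖-⊑ (true ∷ A)  (false ∷ x) = Bool.b≤b ∷ ∪-∖-∖-⊑ A x
  ∪-∖-∖-⊑ (false ∷ A) (true ∷ x)  = Bool.b≤b ∷ ∪-∖-∖-⊑ A x
  ∪-∖-∖-⊑ (false ∷ A) (false ∷ x) = Bool.b≤b ∷ ∪-∖-∖-⊑ A x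

  ∖-∩-⊑ : ∀ {n} (A x : Cube n) → x ∖ (A ∩ x) ⊑ x ∖ A
  ∖-∩-⊑ []          []          = []
  ∖-∩-⊑ (true ∷ A)  (true ∷ x)  = Bool.b≤b ∷ ∖-∩-⊑ A x
  ∖-∩-⊑ (true ∷ A)  (false ∷ x) = Bool.b≤b ∷ ∖-∩-⊑ A x
  ∖-∩-⊑ (false ∷ A) (true ∷ x)  = Bool.b≤b ∷ ∖-∩-⊑ A x
  ∖-∩-⊑ (false ∷ A) (false ∷ x) = Bool.b≤b ∷ ∖-∩-⊑ A x

  ∖-monoˡ : ∀ {n} (A : Cube n) {x y} → x ⊑ y → x ∖ A ⊑ y ∖ A
  ∖-monoˡ []          []        = []
  ∖-monoˡ (true ∷ A)  (_∷_ {x = a} {y = b} _ q) rewrite Boolₚ.∧-zeroʳ a | Boolₚ.∧-zeroʳ b = Bool.b≤b ∷ ∖-monoˡ A q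
  ∖-monoˡ (false ∷ A) (_∷_ {x = a} {y = b} p q) rewrite Boolₚ.∧-identityʳ a | Boolₚ.∧-identityʳ b = p ∷ ∖-monoˡ A q

  ∪-monoˡ : ∀ {n} (A : Cube n) {x y} → x ⊑ y → x ∪ A ⊑ y ∪ A
  ∪-monoˡ []          []        = []
  ∪-monoˡ (true ∷ A)  (_∷_ {x = a} {y = b} _ q) rewrite Boolₚ.∨-zeroʳ a | Boolₚ.∨-zeroʳ b = Bool.b≤b ∷ ∪-monoˡ A q
  ∪-monoˡ (false ∷ A) (_∷_ {x = a} {y = b} p q) rewrite Boolₚ.∨-identityʳ a | Boolₚ.∨-identityʳ b = p ∷ ∪-monoˡ A q

  ∖-⊑ : ∀ {n} (x A : Cube n) → x ∖ A ⊑ x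
  ∖-⊑ []          []      = []
  ∖-⊑ (true ∷ x)  (b ∷ A) = Boolₚ.≤-maximum _ ∷ ∖-⊑ x A
  ∖-⊑ (false ∷ x) (b ∷ A) = Bool.b≤b ∷ ∖-⊑ x A

  ∩-⊑ : ∀ {n} (A x : Cube n) → A ∩ x ⊑ A
  ∩-⊑ []          []      = []
  ∩-⊑ (true ∷ A)  (b ∷ x) = Boolₚ.≤-maximum _ ∷ ∩-⊑ A x
  ∩-⊑ (false ∷ A) (b ∷ x) = Bool.b≤b ∷ ∩-⊑ A x

  ⊑-∖⇒disjoint : ∀ {n} (A x : Cube n) → A ⊑ A ∖ x → disjoint A x ≡ true
  ⊑-∖⇒disjoint []          []          []       = refl
  ⊑-∖⇒disjoint (true ∷ A)  (false ∷ x) (_ ∷ h)  = ⊑-∖⇒disjoint A x h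
  ⊑-∖⇒disjoint (true ∷ A)  (true ∷ x)  (() ∷ h)
  ⊑-∖⇒disjoint (false ∷ A) (b ∷ x)     (_ ∷ h)  = ⊑-∖⇒disjoint A x h

  ⊑-∩⇒contains : ∀ {n} (A x : Cube n) → A ⊑ A ∩ x → contains A x ≡ true
  ⊑-∩⇒contains []          []          []       = refl
  ⊑-∩⇒contains (true ∷ A)  (true ∷ x)  (_ ∷ h)  = ⊑-∩⇒contains A x h
  ⊑-∩⇒contains (true ∷ A)  (false ∷ x) (() ∷ h)
  ⊑-∩⇒contains (false ∷ A) (b ∷ x)     (_ ∷ h)  = ⊑-∩⇒contains A x h

  ⊑-∖-replicate : ∀ {n} (x : Cube n) → x ⊑ x ∖ replicate n false
  ⊑-∖-replicate []          = []
  ⊑-∖-replicate (true ∷ x)  = Bool.b≤b ∷ ⊑-∖-replicate x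
  ⊑-∖-replicate (false ∷ x) = Bool.b≤b ∷ ⊑-∖-replicate x

  ∖-all-⊑ : ∀ {n} (x y : Cube n) → x ∖ replicate n true ⊑ y
  ∖-all-⊑ []          []      = []
  ∖-all-⊑ (true ∷ x)  (b ∷ y) = Boolₚ.≤-minimum b ∷ ∖-all-⊑ x y
  ∖-all-⊑ (false ∷ x) (b ∷ y) = Boolₚ.≤-minimum b ∷ ∖-all-⊑ x y

  -- Minimal sets with a decidable property

  Minimal : ∀ {n} → (Cube n → Set) → Cube n → Set
  Minimal P A = P A × (∀ {A′} → P A′ → A′ ⊑ A → A ⊑ A′)

  -- Sets omitting the first coordinate are searched first, since no set containing it lies below
  -- one that omits it. A set containing it is taken only if none omitting it qualifies.
  minimal? : ∀ {n} {P : Cube n → Set} → Decidable P → ∃ (Minimal P) ⊎ (∀ A → ¬ P A)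
  minimal? {zero} P? with P? []
  ... | yes p = inj₁ ([] , p , λ { {[]} _ _ → [] })
  ... | no ¬p = inj₂ λ { [] → ¬p }
  minimal? {suc n} P? with minimal? (P? ∘ (false ∷_)) | minimal? (P? ∘ (true ∷_))
  ... | inj₁ (A , p , m) | _ = inj₁ (false ∷ A , p , λ { {false ∷ _} q (_ ∷ s) → Bool.b≤b ∷ m q s })
  ... | inj₂ none | inj₁ (A , p , m) =
    inj₁ (true ∷ A , p , λ { {true ∷ _} q (_ ∷ s) → Bool.b≤b ∷ m q s ; {false ∷ A′} q _ → contradiction q (none A′) })
  ... | inj₂ none₀ | inj₂ none₁ = inj₂ λ { (false ∷ A) → none₀ A ; (true ∷ A) → none₁ A }

  -- Compression

  ∏₁ : ∀ {n} → Weights n → Cube n → ℕ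
  ∏₁ []             []          = 1
  ∏₁ ((a , c) ∷ ws) (true ∷ A)  = a * ∏₁ ws A
  ∏₁ ((a , c) ∷ ws) (false ∷ A) = ∏₁ ws A

  ∏₀ : ∀ {n} → Weights n → Cube n → ℕ
  ∏₀ = ∏₁ ∘ dual

  -- Requiring `A` to be present or absent fixes the coordinates in `A` and contributes `∏₁` or
  -- `∏₀`. The other coordinates run over the same points of `K` in both sums, so the cofactor `r`
  -- is common.
  shift-weight : ∀ {n} (ws : Weights n) (A : Cube n) (K : Cube n → Bool) → ∃ λ r →
    W ws (λ x → 𝟙 (contains A x ∧ K (x ∖ A))) ≡ ∏₁ ws A * r ×
    W ws (λ y → 𝟙 (disjoint A y ∧ K y))       ≡ ∏₀ ws A * r
  shift-weight []             []          K = 𝟙 (K []) , ≡.sym (+-identityʳ _) , ≡.sym (+-identityʳ _)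
  shift-weight ((a , c) ∷ ws) (true ∷ A)  K
    with r , p , q ← shift-weight ws A (K ∘ (false ∷_))
    rewrite p | q | W-zero ws | *-zeroʳ a | *-zeroʳ c =
    r , ≡.trans (+-identityʳ _) (≡.sym (*-assoc a _ r)) , ≡.sym (*-assoc c _ r)
  shift-weight ((a , c) ∷ ws) (false ∷ A) K
    with r₁ , p₁ , q₁ ← shift-weight ws A (K ∘ (true ∷_))
       | r₀ , p₀ , q₀ ← shift-weight ws A (K ∘ (false ∷_))
    rewrite p₁ | q₁ | p₀ | q₀ =
    a * r₁ + c * r₀ , pull a c (∏₁ ws A) r₁ r₀ , pull a c (∏₀ ws A) r₁ r₀
    where
    pull : ∀ a c p r s → a * (p * r) + c * (p * s) ≡ p * (a * r + c * s)
    pull = solve-∀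

  -- An up-set of the (n+1)-cube, cut along its first coordinate.
  record Nested (n : ℕ) : Set where
    constructor nested
    field
      {B C} : Cube n → Bool
      B-up  : IsUp B
      C-up  : IsUp C
      B⇒C   : ∀ {x} → B x ≡ true → C x ≡ true

    -- The shift by A moves some point.
    Bad : Cube n → Set
    Bad A = ∃ λ x → B x ≡ true × C (x ∖ A) ≡ false

    bad? : Decidable Bad
    bad? A = Subsetₚ.anySubset? λ x → (B x Boolₚ.≟ true) ×-dec (C (x ∖ A) Boolₚ.≟ false)

    C-down : ∀ {x y} → x ⊑ y → C y ≡ false → C x ≡ false
    C-down x⊑y ¬y = not-true⇒false λ x∈C → contradiction (≡.trans (≡.sym (C-up x⊑y x∈C)) ¬y) λ ()

  family : ∀ {n} → Nested n → Cube (suc n) → Bool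
  family S (true ∷ x)  = Nested.C S x
  family S (false ∷ x) = Nested.B S x

  module Shift {n} (S : Nested n) {A : Cube n} (min : Minimal (Nested.Bad S) A) where

    open Nested S

    minA : ∀ {A′} → Bad A′ → A′ ⊑ A → A ⊑ A′
    minA = proj₂ min

    -- For `y` disjoint from `A`, `K y` says that the pair `y ∪ A`, `y` is exchanged: `y ∪ A` leaves
    -- the section `B` and `y` enters the section `C`. Testing `K` on the point without `A` lets
    -- `shift-weight` compare the two sides.
    K moved gained B′ C′ : Cube n → Bool
    K y      = B (y ∪ A) ∧ not (C y)
    moved x  = contains A x ∧ K (x ∖ A)
    gained y = disjoint A y ∧ K y
    B′ x     = B x ∧ not (moved x)
    C′ y     = C y ∨ gained y

    K-intro : ∀ {y} → B (y ∪ A) ≡ true → C y ≡ false → K y ≡ true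
    K-intro p q rewrite p | q = refl

    K-elim : ∀ y → K y ≡ true → B (y ∪ A) ≡ true × C y ≡ false
    K-elim y k with p , q ← ∧-true k = p , ≡.trans (≡.sym (Boolₚ.not-involutive (C y))) (cong not q)

    -- If `x ∖ A` misses `C`, so does `x ∖ (A ∩ x)`, and `A ∩ x` is bad too. By minimality, a point
    -- of `B` whose shift falls outside `C` already contains all of `A`.
    moved-intro : ∀ {x} → B x ≡ true → C (x ∖ A) ≡ false → moved x ≡ true
    moved-intro {x} x∈B x∖A∉C
      rewrite ⊑-∩⇒contains A x (minA (x , x∈B , C-down (∖-∩-⊑ A x) x∖A∉C) (∩-⊑ A x)) =
      K-intro (B-up (⊑-∖-∪ A x) x∈B) x∖A∉C

    moved⇒B : ∀ x → moved x ≡ true → B x ≡ true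
    moved⇒B x m with c , k ← ∧-true m = B-up (∖-∪-⊑ A x c) (proj₁ (K-elim (x ∖ A) k))

    moved⇒¬C : ∀ x → moved x ≡ true → C (x ∖ A) ≡ false
    moved⇒¬C x m = proj₂ (K-elim (x ∖ A) (proj₂ (∧-true {contains A x} m)))

    gained⇒¬C : ∀ y → gained y ≡ true → C y ≡ false
    gained⇒¬C y g = proj₂ (K-elim y (proj₂ (∧-true {disjoint A y} g)))

    -- Above a point that stays, no point is moved: if `z ∖ A` lies outside `C`, so does `y ∖ A`
    -- below it, and `y` would have been moved as well.
    B′-up : IsUp B′
    B′-up {y} {z} y⊑z y∈B′ with ∧-true y∈B′
    ... | y∈B , ¬my with moved z in mz
    ... | false = ≡.trans (Boolₚ.∧-identityʳ (B z)) (B-up y⊑z y∈B)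
    ... | true  = contradiction (≡.trans (≡.sym ¬my) (cong not my)) λ ()
      where my = moved-intro y∈B (C-down (∖-monoˡ A y⊑z) (moved⇒¬C z mz))

    -- The delicate case is `y` newly gained and `z` outside `C`. Then `z ∪ A` lies in `B`, and
    -- taking `A ∖ z` away from it leaves a point below `z`, hence outside `C`. So `A ∖ z` is bad,
    -- minimality makes `A` disjoint from `z`, and `z` is gained too.
    C′-up : IsUp C′
    C′-up {y} {z} y⊑z y∈C′ with C z in cz | C y in cy
    ... | true  | _    = refl
    ... | false | true = contradiction (≡.trans (≡.sym (C-up y⊑z cy)) cz) λ ()
    ... | false | false with ∧-true {disjoint A y} y∈C′
    ... | _ , k with z∪A∈B ← B-up (∪-monoˡ A y⊑z) (proj₁ (∧-true k))
      rewrite ⊑-∖⇒disjoint A z (minA (z ∪ A , z∪A∈B , C-down (∪-∖-∖-⊑ A z) cz) (∖-⊑ A z))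
            | z∪A∈B = refl

    shifted : Nested n
    shifted = nested B′-up C′-up λ {x} x∈B′ → ∨-trueˡ (B⇒C (proj₁ (∧-true {B x} x∈B′)))
      where
      ∨-trueˡ : ∀ {a b} → a ≡ true → a ∨ b ≡ true
      ∨-trueˡ refl = refl

    W-B : ∀ ws → W ws (𝟙 ∘ B) ≡ W ws (𝟙 ∘ B′) + W ws (𝟙 ∘ moved)
    W-B ws = ≡.trans (W-cong ws λ x → 𝟙-split (moved⇒B x)) (W-+ ws (𝟙 ∘ B′) (𝟙 ∘ moved))

    W-C : ∀ ws → W ws (𝟙 ∘ C′) ≡ W ws (𝟙 ∘ C) + W ws (𝟙 ∘ gained)
    W-C ws = ≡.trans (W-cong ws λ x → 𝟙-join (gained⇒¬C x)) (W-+ ws (𝟙 ∘ C) (𝟙 ∘ gained))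

    -- The shift by the empty set fixes every point, and `B` lies in `C`. Hence the shift condition
    -- applies to every bad set that is chosen.
    A-nonempty : A ≢ replicate n false
    A-nonempty refl with x , x∈B , x∖A∉C ← proj₁ min =
      contradiction (≡.trans (≡.sym (C-up (⊑-∖-replicate x) (B⇒C x∈B))) x∖A∉C) λ ()

    B′-smaller : W (units n) (𝟙 ∘ B′) < W (units n) (𝟙 ∘ B)
    B′-smaller with x , x∈B , x∖A∉C ← proj₁ min
      rewrite W-B (units n) =
      m<m+n _ (≤-trans (≤-reflexive (≡.sym (cong 𝟙 (moved-intro x∈B x∖A∉C)))) (W-point (𝟙 ∘ moved) x))

    -- The shift trades the weight `c * (P * r)` of the moved points for the weight `a * (Q * r)` of
    -- the gained ones, with the common `r` of `shift-weight`.
    shift-primal : ∀ a c ws → c * ∏₁ ws A ≤ a * ∏₀ ws A →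
      W ((a , c) ∷ ws) (𝟙 ∘ family S) ≤ W ((a , c) ∷ ws) (𝟙 ∘ family shifted)
    shift-primal a c ws h
      with r , p , q ← shift-weight ws A K
      rewrite W-B ws | W-C ws | p | q = begin
      a * k + c * (b′ + P * r)       ≡⟨ lhs a b′ c k P r ⟩
      (c * P) * r + (a * k + c * b′) ≤⟨ +-monoˡ-≤ _ (*-monoˡ-≤ r h) ⟩
      (a * Q) * r + (a * k + c * b′) ≡⟨ rhs a b′ c k Q r ⟩
      a * (k + Q * r) + c * b′       ∎
      where
      b′ = W ws (𝟙 ∘ B′)
      k  = W ws (𝟙 ∘ C)
      P  = ∏₁ ws A
      Q  = ∏₀ ws A
      lhs : ∀ a b c k P r → a * k + c * (b + P * r) ≡ (c * P) * r + (a * k + c * b)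
      lhs = solve-∀
      rhs : ∀ a b c k Q r → (a * Q) * r + (a * k + c * b) ≡ a * (k + Q * r) + c * b
      rhs = solve-∀

    -- Dualising swaps `a` with `c` and the two products. Now the gained points weigh `c * (P * r)`
    -- and the moved ones `a * (Q * r)`, so the same inequality works in the opposite direction.
    shift-dual : ∀ a c ws → c * ∏₁ ws A ≤ a * ∏₀ ws A →
      W (dual ((a , c) ∷ ws)) (𝟙 ∘ family shifted) ≤ W (dual ((a , c) ∷ ws)) (𝟙 ∘ family S)
    shift-dual a c ws h
      with r , p , q ← shift-weight (dual ws) A K
      rewrite W-B (dual ws) | W-C (dual ws) | p | q | dual-involutive ws = begin
      c * (k + P * r) + a * b′       ≡⟨ lhs a b′ c k P r ⟩
      (c * P) * r + (c * k + a * b′) ≤⟨ +-monoˡ-≤ _ (*-monoˡ-≤ r h) ⟩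
      (a * Q) * r + (c * k + a * b′) ≡⟨ rhs a b′ c k Q r ⟩
      c * k + a * (b′ + Q * r)       ∎
      where
      b′ = W (dual ws) (𝟙 ∘ B′)
      k  = W (dual ws) (𝟙 ∘ C)
      P  = ∏₁ ws A
      Q  = ∏₀ ws A
      lhs : ∀ a b c k P r → c * (k + P * r) + a * b ≡ (c * P) * r + (c * k + a * b)
      lhs = solve-∀
      rhs : ∀ a b c k Q r → (a * Q) * r + (c * k + a * b) ≡ c * k + a * (b + Q * r)
      rhs = solve-∀

  -- In terms of the ratios `c / a` of the coordinates, this is the hypothesis that the product of
  -- ratios over a nonempty `A` is at least the ratio of the last factor, cleared of denominators.
  ShiftCondition : ∀ {n} → ℕ → ℕ → Weights n → Set
  ShiftCondition {n} a c ws = ∀ A → A ≢ replicate n false → c * ∏₁ ws A ≤ a * ∏₀ ws A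

  Extreme : ∀ {n} → Nested n → Set
  Extreme S = (∀ x → Nested.B S x ≡ false) ⊎ (∀ x → Nested.C S x ≡ true)

  infix 4 _≼[_]_

  _≼[_]_ : ∀ {n} → Nested n → Weights (suc n) → Nested n → Set
  S ≼[ ws ] T = W ws (𝟙 ∘ family S) ≤ W ws (𝟙 ∘ family T) × W (dual ws) (𝟙 ∘ family T) ≤ W (dual ws) (𝟙 ∘ family S)

  -- Shifts strictly shrink B.  Once no set is bad, neither is the full set, so a
  -- point of B forces the empty set, hence everything, into C.
  compress : ∀ {n} a c (ws : Weights n) → ShiftCondition a c ws → (S : Nested n) →
             ∃ λ T → Extreme T × S ≼[ (a , c) ∷ ws ] T
  compress {n} a c ws cond S = go S (<-wellFounded _)
    where
    go : ∀ S → Acc _<_ (W (units n) (𝟙 ∘ Nested.B S)) → ∃ λ T → Extreme T × S ≼[ (a , c) ∷ ws ] T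
    go S (acc rs) with minimal? (Nested.bad? S)
    ... | inj₁ (A , min) with T , ext , p , q ← go (Shift.shifted S min) (rs (Shift.B′-smaller S min)) =
      T , ext , ≤-trans (Shift.shift-primal S min a c ws h) p , ≤-trans q (Shift.shift-dual S min a c ws h)
      where h = cond A (Shift.A-nonempty S min)
    ... | inj₂ none with Subsetₚ.anySubset? (λ x → Nested.B S x Boolₚ.≟ true)
    ... | no  B-empty   = S , inj₁ (λ x → not-true⇒false λ x∈B → B-empty (x , x∈B)) , ≤-refl , ≤-refl
    ... | yes (x , x∈B) = S , inj₂ C-full , ≤-refl , ≤-refl
      where
      C-full : ∀ y → Nested.C S y ≡ true
      C-full y with Nested.C S (x ∖ replicate n true) in eq
      ... | true  = Nested.C-up S (∖-all-⊑ x y) eq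
      ... | false = contradiction (x , x∈B , eq) (none _)

open WeightedCube

-- From vertex sets of products to up-sets of cubes

module CubeModels where

  open import Data.Nat using (_+_; _*_; _≤_; _<_)
  open import Data.Nat.Properties
  open import Algebra.Properties.Semiring.Sum +-*-semiring using (sum; sum-cong-≗; ∑-distrib-+; *-distribˡ-sum)
  open ℕₚ.≤-Reasoning

  false≢true : false ≢ true
  false≢true ()

  ≡⇒T : ∀ {b} → b ≡ true → T b
  ≡⇒T = Equivalence.from Boolₚ.T-≡

  T⇒≡ : ∀ {b} → T b → b ≡ true
  T⇒≡ = Equivalence.to Boolₚ.T-≡

  ∧-intro : ∀ {a b} → a ≡ true → b ≡ true → a ∧ b ≡ true
  ∧-intro refl refl = refl

  any-intro : ∀ {n} (f : Fin n → Bool) i → f i ≡ true → any f (allFin n) ≡ true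
  any-intro f i fi = T⇒≡ (any⁺ f (lose (∈-allFin i) (≡⇒T fi)))

  any-elim : ∀ {n} (f : Fin n → Bool) → any f (allFin n) ≡ true → ∃ λ i → f i ≡ true
  any-elim f h with i , fi ← satisfied (any⁻ f (allFin _) (≡⇒T h)) = i , T⇒≡ fi

  all-intro : ∀ {n} (f : Fin n → Bool) → (∀ i → f i ≡ true) → all f (allFin n) ≡ true
  all-intro f h = T⇒≡ (all⁻ f (All.universal (≡⇒T ∘ h) (allFin _)))

  all-elim : ∀ {n} (f : Fin n → Bool) → all f (allFin n) ≡ true → ∀ i → f i ≡ true
  all-elim f h i = T⇒≡ (All.lookup (all⁺ f (allFin _) (≡⇒T h)) (∈-allFin i))

  -- Finite sums

  sum-mono : ∀ {n} {f g : Fin n → ℕ} → (∀ i → f i ≤ g i) → sum f ≤ sum g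
  sum-mono {zero}  h = z≤n
  sum-mono {suc n} h = +-mono-≤ (h zero) (sum-mono (h ∘ suc))

  sum-ones : ∀ n → sum {n} (const 1) ≡ n
  sum-ones zero    = refl
  sum-ones (suc n) = cong suc (sum-ones n)

  sum-point : ∀ {n} (f : Fin n → ℕ) i → f i ≤ sum f
  sum-point f zero    = m≤m+n _ _
  sum-point f (suc i) = ≤-trans (sum-point (f ∘ suc) i) (m≤n+m _ _)

  sum-linear : ∀ {n} a c (f g : Fin n → ℕ) → sum (λ i → a * f i + c * g i) ≡ a * sum f + c * sum g
  sum-linear a c f g = ≡.trans (∑-distrib-+ (λ i → a * f i) (λ i → c * g i))
    (cong₂ _+_ (≡.sym (*-distribˡ-sum a f)) (≡.sym (*-distribˡ-sum c g)))

  sum-↑ : ∀ m n (f : Fin (m + n) → ℕ) → sum f ≡ sum (λ i → f (i ↑ˡ n)) + sum (λ j → f (m ↑ʳ j))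
  sum-↑ zero    n f = refl
  sum-↑ (suc m) n f = ≡.trans (cong (f zero +_) (sum-↑ m n (f ∘ suc))) (≡.sym (+-assoc (f zero) _ _))

  sum-combine : ∀ m n (f : Fin (m * n) → ℕ) → sum f ≡ sum {m} (λ i → sum {n} (λ j → f (combine i j)))
  sum-combine zero    n f = refl
  sum-combine (suc m) n f = ≡.trans (sum-↑ n (m * n) f) (cong (sum (λ j → f (j ↑ˡ (m * n))) +_) (sum-combine m n (λ j → f (n ↑ʳ j))))

  -- Vertex sets are mostly handled as Boolean functions, which compose with maps such as `type`;
  -- `∣∣≡size` links them to `Subset`.
  size : ∀ {n} → (Fin n → Bool) → ℕ
  size s = sum (𝟙 ∘ s)

  size-mono : ∀ {n} {s t : Fin n → Bool} → (∀ i → s i ≡ true → t i ≡ true) → size s ≤ size t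
  size-mono h = sum-mono (𝟙-mono ∘ h)

  size-total : ∀ {n} (s : Fin n → Bool) → size s ≤ n
  size-total {n} s = ≤-trans (sum-mono (𝟙≤1 ∘ s)) (≤-reflexive (sum-ones n))
    where
    𝟙≤1 : ∀ b → 𝟙 b ≤ 1
    𝟙≤1 true  = ≤-refl
    𝟙≤1 false = z≤n

  size-full : ∀ {n} (s : Fin n → Bool) → (∀ i → s i ≡ true) → size s ≡ n
  size-full {n} s h = ≡.trans (sum-cong-≗ (cong 𝟙 ∘ h)) (sum-ones n)

  size-none : ∀ {n} → size {n} (const false) ≡ 0
  size-none {zero}  = refl
  size-none {suc n} = size-none {n}

  size-not : ∀ {n} (s : Fin n → Bool) → size s + size (not ∘ s) ≡ n
  size-not {n} s =
    ≡.trans (≡.sym (∑-distrib-+ (𝟙 ∘ s) (𝟙 ∘ not ∘ s))) (≡.trans (sum-cong-≗ (one ∘ s)) (sum-ones n))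
    where
    one : ∀ b → 𝟙 b + 𝟙 (not b) ≡ 1
    one true  = refl
    one false = refl

  ∣∣≡size : ∀ {n} (S : Subset n) → ∣ S ∣ ≡ size (lookup S)
  ∣∣≡size []          = refl
  ∣∣≡size (true ∷ S)  = cong suc (∣∣≡size S)
  ∣∣≡size (false ∷ S) = ∣∣≡size S

  ∣tabulate∣≡size : ∀ {n} (s : Fin n → Bool) → ∣ tabulate s ∣ ≡ size s
  ∣tabulate∣≡size s = ≡.trans (∣∣≡size (tabulate s)) (sum-cong-≗ (cong 𝟙 ∘ Vecₚ.lookup∘tabulate s))

  ∈-allSubsets : ∀ {n} (S : Subset n) → S ∈ allSubsets n
  ∈-allSubsets []          = here refl
  ∈-allSubsets (true ∷ S)  = ∈-++⁺ˡ (∈-map⁺ (true ∷_) (∈-allSubsets S))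
  ∈-allSubsets (false ∷ S) = ∈-++⁺ʳ _ (∈-map⁺ (false ∷_) (∈-allSubsets S))

  -- Boundaries and independent sets

  boundary : (G : Graph) → (Fin (V G) → Bool) → Fin (V G) → Bool
  boundary G s w = any (λ v → s v ∧ adj G v w) (allFin (V G))

  boundary-intro : ∀ G s {v w} → s v ≡ true → adj G v w ≡ true → boundary G s w ≡ true
  boundary-intro G s {v} sv vw = any-intro _ v (∧-intro sv vw)

  boundary-elim : ∀ G s w → boundary G s w ≡ true → ∃ λ v → s v ≡ true × adj G v w ≡ true
  boundary-elim G s w h with v , p ← any-elim _ h = v , ∧-true p

  boundary-mono : ∀ G {s t} → (∀ v → s v ≡ true → t v ≡ true) → ∀ w → boundary G s w ≡ true → boundary G t w ≡ true
  boundary-mono G {s} {t} h w b with v , sv , vw ← boundary-elim G s w b = boundary-intro G t (h v sv) vw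

  Independent : (G : Graph) → (Fin (V G) → Bool) → Set
  Independent G s = ∀ u v → s u ≡ true → s v ≡ true → adj G u v ≡ false

  module _ (G : Graph) where

    private
      independentSize : Subset (V G) → ℕ
      independentSize S = if isIndependent G S then ∣ S ∣ else 0

    isIndependent-sound : ∀ S → isIndependent G S ≡ true → Independent G (lookup S)
    isIndependent-sound S h u v su sv
      with q ← all-elim _ (all-elim _ h u) v rewrite su | sv =
      ≡.trans (≡.sym (Boolₚ.not-involutive _)) (cong not q)

    isIndependent-complete : ∀ S → Independent G (lookup S) → isIndependent G S ≡ true
    isIndependent-complete S h = all-intro _ λ u → all-intro _ λ v → go u v
      where
      go : ∀ u v → not (lookup S u ∧ lookup S v ∧ adj G u v) ≡ true
      go u v with lookup S u in su | lookup S v in sv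
      ... | false | _     = refl
      ... | true  | false = refl
      ... | true  | true  = cong not (h u v su sv)

    size≤α : ∀ s → Independent G s → size s ≤ α G
    size≤α s ind = Listₚ.foldr-preservesᵒ {P = size s ≤_} step 0 _
      (inj₂ (lose (∈-map⁺ independentSize (∈-allSubsets (tabulate s))) (≤-reflexive eq)))
      where
      step : ∀ x y → size s ≤ x ⊎ size s ≤ y → size s ≤ x ℕ.⊔ y
      step x y (inj₁ p) = m≤n⇒m≤n⊔o y p
      step x y (inj₂ p) = m≤n⇒m≤o⊔n x p
      eq : size s ≡ independentSize (tabulate s)
      eq rewrite isIndependent-complete (tabulate s)
                   (λ u v su sv → ind u v (≡.trans (≡.sym (Vecₚ.lookup∘tabulate s u)) su)
                                          (≡.trans (≡.sym (Vecₚ.lookup∘tabulate s v)) sv)) =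
        ≡.sym (∣tabulate∣≡size s)

    α≤V : α G ≤ V G
    α≤V = Listₚ.foldr-preservesᵇ {P = _≤ V G} ⊔-lub z≤n (All.tabulate bound)
      where
      bound : ∀ {x} → x ∈ map independentSize (allSubsets (V G)) → x ≤ V G
      bound x∈ with S , _ , refl ← ∈-map⁻ independentSize x∈ with isIndependent G S
      ... | true  = ≤-trans (≤-reflexive (∣∣≡size S)) (size-total (lookup S))
      ... | false = z≤n

    private
      -- The fold for `α` can return 0 as its initial value or from a set that is not independent;
      -- in both cases the empty set attains it.
      empty-attains : 0 ≡ α G → ∃ λ s → Independent G s × size s ≡ α G
      empty-attains eq = const false , (λ _ _ ()) ,
        ≡.trans (n≤0⇒n≡0 (≤-trans (size≤α (const false) (λ _ _ ())) (≤-reflexive (≡.sym eq)))) eq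

    α-attained : ∃ λ s → Independent G s × size s ≡ α G
    α-attained with foldr-selective ⊔-sel 0 (map independentSize (allSubsets (V G)))
    ... | inj₁ eq = empty-attains (≡.sym eq)
    ... | inj₂ m  with S , _ , eq ← ∈-map⁻ independentSize m with isIndependent G S in ind
    ... | true  = lookup S , isIndependent-sound S ind , ≡.trans (≡.sym (∣∣≡size S)) (≡.sym eq)
    ... | false = empty-attains (≡.sym eq)

    α>0 : 0 < α G
    α>0 = ≤-trans (≤-trans (≤-reflexive (≡.sym (cong 𝟙 (dec-refl v)))) (sum-point (𝟙 ∘ point) v)) (size≤α point ind)
      where
      instance _ = nz G
      v : Fin (V G)
      v = Fin.fromℕ< (ℕ.>-nonZero⁻¹ (V G))
      point : Fin (V G) → Bool
      point u = does (u Finₚ.≟ v)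
      dec-refl : ∀ u → does (u Finₚ.≟ u) ≡ true
      dec-refl u with u Finₚ.≟ u
      ... | yes _ = refl
      ... | no ¬p = contradiction refl ¬p
      ind : Independent G point
      ind u w pu pw with u Finₚ.≟ v | w Finₚ.≟ v
      ... | yes refl | yes refl = irrefl G v

  -- One complete multipartite factor

  -- Whether a section is nonempty (true) or contains an edge (false).
  level : (H : Graph) → Bool → (Fin (V H) → Bool) → Bool
  level H true  t = any t (allFin (V H))
  level H false t = any (λ k → t k ∧ boundary H t k) (allFin (V H))

  level-mono : ∀ H b {s t} → (∀ v → s v ≡ true → t v ≡ true) → level H b s ≡ true → level H b t ≡ true
  level-mono H true  {s} {t} h l with k , p ← any-elim _ l = any-intro t k (h k p)
  level-mono H false h l with k , p ← any-elim _ l with tk , bk ← ∧-true p =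
    any-intro _ k (∧-intro (h k tk) (boundary-mono H h k bk))

  level-false⇒true : ∀ H {t} → level H false t ≡ true → level H true t ≡ true
  level-false⇒true H {t} l with k , p ← any-elim _ l = any-intro t k (proj₁ (∧-true p))

  module Factor (H : Graph) (cm : CompleteMultipartite H) where

    a c : ℕ
    a = α H
    c = V H ∸ α H

    a+c : a + c ≡ V H
    a+c = m+[n∸m]≡n (α≤V H)

    part   = proj₁ (proj₂ cm)
    adj⇒≢  = λ u v → proj₁ (proj₂ (proj₂ cm) u v)
    ≢⇒adj  = λ u v → proj₂ (proj₂ (proj₂ cm) u v)

    -- The ends of an edge lie in different parts, so `h` shares its part with at most one of them.
    adj-cover : ∀ {k l} h → adj H k l ≡ true → adj H k h ≡ true ⊎ adj H l h ≡ true
    adj-cover {k} {l} h kl with part k Finₚ.≟ part h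
    ... | no  k≢h = inj₁ (≢⇒adj k h k≢h)
    ... | yes k≡h = inj₂ (≢⇒adj l h λ l≡h → adj⇒≢ k l kl (≡.trans k≡h (≡.sym l≡h)))

    ¬adj⇒≡ : ∀ u v → adj H u v ≡ false → part u ≡ part v
    ¬adj⇒≡ u v ¬uv with part u Finₚ.≟ part v
    ... | yes p = p
    ... | no ¬p = contradiction (≡.trans (≡.sym ¬uv) (≢⇒adj u v ¬p)) false≢true

    -- The vertices not adjacent to `k` all lie in the part of `k`, so they form an independent set
    -- of at most `a` vertices.
    degree≥c : ∀ k → c ≤ size (adj H k)
    degree≥c k = +-cancelˡ-≤ a _ _ (begin
      a + c                                    ≡⟨ a+c ⟩
      V H                                      ≡⟨ size-not (adj H k) ⟨
      size (adj H k) + size (not ∘ adj H k)    ≤⟨ +-monoʳ-≤ (size (adj H k)) (size≤α H (not ∘ adj H k) ind) ⟩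
      size (adj H k) + a                       ≡⟨ +-comm _ a ⟩
      a + size (adj H k)                       ∎)
      where
      ¬adj : ∀ u → not (adj H k u) ≡ true → adj H k u ≡ false
      ¬adj u p = ≡.trans (≡.sym (Boolₚ.not-involutive _)) (cong not p)
      ind : Independent H (not ∘ adj H k)
      ind u v ku kv = not-true⇒false λ uv →
        adj⇒≢ u v uv (≡.trans (≡.sym (¬adj⇒≡ k u (¬adj u ku))) (¬adj⇒≡ k v (¬adj v kv)))

    -- A set without an edge is independent, which caps it at `a`; a set with an edge is only
    -- bounded by the whole `a + c`.
    level-size : ∀ t → size t ≤ a * 𝟙 (level H true t) + c * 𝟙 (level H false t)
    level-size t with level H false t in l₀ | level H true t in l₁
    ... | true  | false = contradiction (≡.trans (≡.sym l₁) (level-false⇒true H {t} l₀)) false≢true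
    ... | true  | true  rewrite *-identityʳ a | *-identityʳ c | a+c = size-total t
    ... | false | true  rewrite *-identityʳ a = ≤-trans (size≤α H t ind) (m≤m+n a _)
      where
      ind : Independent H t
      ind u v tu tv = not-true⇒false λ uv → contradiction
        (≡.trans (≡.sym l₀) (any-intro _ v (∧-intro tv (boundary-intro H t tu uv)))) false≢true
    ... | false | false = ≤-trans (size-mono {t = const false}
        λ v tv → contradiction (≡.trans (≡.sym l₁) (any-intro t v tv)) false≢true)
        (≤-trans (≤-reflexive (size-none {V H})) z≤n)

    -- One vertex already has `c` neighbours, and by `adj-cover` the two ends of an edge together
    -- reach every vertex.
    level-boundary : ∀ t → c * 𝟙 (level H true t) + a * 𝟙 (level H false t) ≤ size (boundary H t)
    level-boundary t with level H false t in l₀ | level H true t in l₁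
    ... | true  | false = contradiction (≡.trans (≡.sym l₁) (level-false⇒true H {t} l₀)) false≢true
    ... | false | false rewrite *-zeroʳ a | *-zeroʳ c = z≤n
    ... | false | true  with k , tk ← any-elim t l₁ rewrite *-identityʳ c | *-zeroʳ a | +-identityʳ c =
      ≤-trans (degree≥c k) (size-mono {s = adj H k} {t = boundary H t} λ h kh → boundary-intro H t tk kh)
    ... | true  | true  with l , p ← any-elim _ l₀
      with tl , bl ← ∧-true p with k , tk , kl ← boundary-elim H t l bl
      rewrite *-identityʳ c | *-identityʳ a | +-comm c a | a+c =
      ≤-reflexive (≡.sym (size-full (boundary H t) covers))
      where
      covers : ∀ h → boundary H t h ≡ true
      covers h with adj-cover h kl
      ... | inj₁ kh = boundary-intro H t tk kh
      ... | inj₂ lh = boundary-intro H t tl lh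

    I : Fin (V H) → Bool
    I = proj₁ (α-attained H)

    I-independent : Independent H I
    I-independent = proj₁ (proj₂ (α-attained H))

    -- The set `I` has `a` vertices and its complement has `c`, so `I` carries the counting measure
    -- of `H` to a coordinate of weight `(a , c)`.
    sum-I : ∀ (g : Bool → ℕ) → sum (g ∘ I) ≡ a * g true + c * g false
    sum-I g = ≡.trans (sum-cong-≗ (by-cases ∘ I)) (≡.trans (sum-linear (g true) (g false) (𝟙 ∘ I) (𝟙 ∘ not ∘ I))
      (cong₂ _+_ (≡.trans (cong (g true *_) size-I) (*-comm (g true) a))
                 (≡.trans (cong (g false *_) size-¬I) (*-comm (g false) c))))
      where
      size-I : size I ≡ a
      size-I = proj₂ (proj₂ (α-attained H))
      size-¬I : size (not ∘ I) ≡ c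
      size-¬I = +-cancelˡ-≡ a _ _ (≡.trans (cong (_+ size (not ∘ I)) (≡.sym size-I)) (≡.trans (size-not I) (≡.sym a+c)))
      by-cases : ∀ b → g b ≡ g true * 𝟙 b + g false * 𝟙 (not b)
      by-cases true  rewrite *-identityʳ (g true) | *-zeroʳ (g false) = ≡.sym (+-identityʳ _)
      by-cases false rewrite *-identityʳ (g false) | *-zeroʳ (g true) = refl

    I-opposite : ∀ u v → adj H u v ≡ true → I u Bool.≤ not (I v)
    I-opposite u v uv with I u in iu | I v in iv
    ... | false | b     = Boolₚ.≤-minimum _
    ... | true  | false = Bool.b≤b
    ... | true  | true  = contradiction (≡.trans (≡.sym (I-independent u v iu iv)) uv) false≢true

  -- Products as weighted cubes

  -- type realizes up-sets of the cube in G, and shadow sends subsets of G to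
  -- up-sets that are no smaller and have no larger boundary.
  record CubeModel (G : Graph) {n} (ws : Weights n) : Set where
    field
      type       : Fin (V G) → Cube n
      sum-type   : ∀ f → sum (f ∘ type) ≡ W ws f
      type-adj   : ∀ u v → adj G u v ≡ true → type u ⊑ Vec.map not (type v)
      shadow     : (Fin (V G) → Bool) → Cube n → Bool
      shadow-mono : ∀ {s t} → (∀ v → s v ≡ true → t v ≡ true) → ∀ x → shadow s x ≡ true → shadow t x ≡ true
      shadow-up  : ∀ s → IsUp (shadow s)
      shadow-size : ∀ s → size s ≤ W ws (𝟙 ∘ shadow s)
      shadow-boundary : ∀ s → W (dual ws) (𝟙 ∘ shadow s) ≤ size (boundary G s)

    realize-size : ∀ F → size (F ∘ type) ≡ W ws (𝟙 ∘ F)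
    realize-size F = sum-type (𝟙 ∘ F)

    -- If `v` has its type in `F` and is adjacent to `w`, the complement of the type of `w` lies
    -- above the type of `v`, hence in `F`. So the boundary lies in a set of complements, which
    -- `W-dual` measures.
    realize-boundary : ∀ F → IsUp F → size (boundary G (F ∘ type)) ≤ W (dual ws) (𝟙 ∘ F)
    realize-boundary F up = begin
      size (boundary G (F ∘ type))     ≤⟨ size-mono opposite ⟩
      size (F ∘ Vec.map not ∘ type)    ≡⟨ sum-type (𝟙 ∘ F ∘ Vec.map not) ⟩
      W ws (𝟙 ∘ F ∘ Vec.map not)       ≡⟨ W-dual ws (𝟙 ∘ F) ⟩
      W (dual ws) (𝟙 ∘ F)              ∎
      where
      opposite : ∀ w → boundary G (F ∘ type) w ≡ true → F (Vec.map not (type w)) ≡ true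
      opposite w b with v , Fv , vw ← boundary-elim G (F ∘ type) w b = up (type-adj v w vw) Fv

    W-ones : W ws (const 1) ≡ V G
    W-ones = ≡.trans (≡.sym (sum-type (const 1))) (sum-ones (V G))

    W-dual-ones : W (dual ws) (const 1) ≡ V G
    W-dual-ones = ≡.trans (≡.sym (W-dual ws (const 1))) W-ones

  weight : Graph → ℕ × ℕ
  weight H = α H , V H ∸ α H

  single : ∀ H → CompleteMultipartite H → CubeModel H (weight H ∷ [])
  single H cm = record
    { type = λ v → I v ∷ []
    ; sum-type = λ f → sum-I (λ b → f (b ∷ []))
    ; type-adj = λ u v uv → I-opposite u v uv ∷ []
    ; shadow = λ { s (b ∷ []) → level H b s }
    ; shadow-mono = λ { h (b ∷ []) → level-mono H b h }
    ; shadow-up = λ { s (Bool.b≤b ∷ []) p → p ; s (Bool.f≤t ∷ []) p → level-false⇒true H p }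
    ; shadow-size = level-size
    ; shadow-boundary = level-boundary
    }
    where open Factor H cm

  module _ {G H : Graph} {n} {ws : Weights n} (M : CubeModel G ws) (cm : CompleteMultipartite H) where
    private
      module M = CubeModel M
      open Factor H cm
      GH = G ×G H

      section : (Fin (V GH) → Bool) → Fin (V G) → Fin (V H) → Bool
      section s x h = s (combine x h)

      levels : Bool → (Fin (V GH) → Bool) → Fin (V G) → Bool
      levels b s x = level H b (section s x)

      combine-adj : ∀ {x y h k} → adj G x y ≡ true → adj H h k ≡ true → adj GH (combine x h) (combine y k) ≡ true
      combine-adj {x} {y} {h} {k} xy hk = ≡.trans
        (cong₂ (λ p q → adj G (proj₁ p) (proj₁ q) ∧ adj H (proj₂ p) (proj₂ q))
               (Finₚ.remQuot-combine x h) (Finₚ.remQuot-combine y k))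
        (∧-intro xy hk)

      type : Fin (V GH) → Cube (suc n)
      type u = I (proj₂ (remQuot {V G} (V H) u)) ∷ M.type (proj₁ (remQuot {V G} (V H) u))

      type-combine : ∀ x h → type (combine x h) ≡ I h ∷ M.type x
      type-combine x h = cong (λ p → I (proj₂ p) ∷ M.type (proj₁ p)) (Finₚ.remQuot-combine x h)

      sum-type : ∀ f → sum (f ∘ type) ≡ W (weight H ∷ ws) f
      sum-type f = begin-equality
        sum (f ∘ type)
          ≡⟨ sum-combine (V G) (V H) (f ∘ type) ⟩
        sum {V G} (λ x → sum {V H} (λ h → f (type (combine x h))))
          ≡⟨ sum-cong-≗ {V G} (λ x → ≡.trans (sum-cong-≗ {V H} (λ h → cong f (type-combine x h))) (sum-I (λ b → f (b ∷ M.type x)))) ⟩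
        sum (λ x → a * f (true ∷ M.type x) + c * f (false ∷ M.type x))
          ≡⟨ sum-linear {V G} a c (λ x → f (true ∷ M.type x)) (λ x → f (false ∷ M.type x)) ⟩
        a * sum (λ x → f (true ∷ M.type x)) + c * sum (λ x → f (false ∷ M.type x))
          ≡⟨ cong₂ (λ p q → a * p + c * q) (M.sum-type (f ∘ (true ∷_))) (M.sum-type (f ∘ (false ∷_))) ⟩
        W (weight H ∷ ws) f ∎

      shadow : (Fin (V GH) → Bool) → Cube (suc n) → Bool
      shadow s (b ∷ x) = M.shadow (levels b s) x

      shadow-up : ∀ s → IsUp (shadow s)
      shadow-up s (Bool.b≤b ∷ x⊑y) p = M.shadow-up _ x⊑y p
      shadow-up s (Bool.f≤t ∷ x⊑y) p = M.shadow-up _ x⊑y (M.shadow-mono (λ v → level-false⇒true H) _ p)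

      shadow-size : ∀ s → size s ≤ W (weight H ∷ ws) (𝟙 ∘ shadow s)
      shadow-size s = begin
        size s
          ≡⟨ sum-combine (V G) (V H) (𝟙 ∘ s) ⟩
        sum (λ x → size (section s x))
          ≤⟨ sum-mono {V G} (λ x → level-size (section s x)) ⟩
        sum (λ x → a * 𝟙 (levels true s x) + c * 𝟙 (levels false s x))
          ≡⟨ sum-linear {V G} a c (𝟙 ∘ levels true s) (𝟙 ∘ levels false s) ⟩
        a * size (levels true s) + c * size (levels false s)
          ≤⟨ +-mono-≤ (*-monoʳ-≤ a (M.shadow-size _)) (*-monoʳ-≤ c (M.shadow-size _)) ⟩
        W (weight H ∷ ws) (𝟙 ∘ shadow s) ∎

      -- An edge from `y` to `x` lifts every boundary vertex of the section over `y` to one over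
      -- `x`.
      fibre-boundary : ∀ s {x y} → adj G y x ≡ true →
        c * 𝟙 (levels true s y) + a * 𝟙 (levels false s y) ≤ sum {V H} (λ h → 𝟙 (boundary GH s (combine x h)))
      fibre-boundary s {x} {y} yx = ≤-trans (level-boundary (section s y)) (size-mono lift)
        where
        lift : ∀ h → boundary H (section s y) h ≡ true → boundary GH s (combine x h) ≡ true
        lift h b with k , sk , kh ← boundary-elim H (section s y) h b = boundary-intro GH s sk (combine-adj yx kh)

      -- The two indicators could have different neighbours of `x` as witnesses. But a section with
      -- an edge is nonempty, so a witness for the edge level serves both, and `fibre-boundary` is
      -- applied to a single `y`.
      boundary-fibre : ∀ s x →
        c * 𝟙 (boundary G (levels true s) x) + a * 𝟙 (boundary G (levels false s) x)
          ≤ sum {V H} (λ h → 𝟙 (boundary GH s (combine x h)))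
      boundary-fibre s x with boundary G (levels false s) x in b₀ | boundary G (levels true s) x in b₁
      ... | false | false rewrite *-zeroʳ a | *-zeroʳ c = z≤n
      ... | false | true with y , ly , yx ← boundary-elim G (levels true s) x b₁ = begin
        c * 1 + a * 0
          ≤⟨ +-mono-≤ (*-monoʳ-≤ c (≤-reflexive (cong 𝟙 (≡.sym ly)))) (*-monoʳ-≤ a z≤n) ⟩
        c * 𝟙 (levels true s y) + a * 𝟙 (levels false s y)
          ≤⟨ fibre-boundary s yx ⟩
        sum {V H} (λ h → 𝟙 (boundary GH s (combine x h))) ∎
      ... | true | b with y , ly , yx ← boundary-elim G (levels false s) x b₀ = begin
        c * 𝟙 b + a * 1
          ≤⟨ +-mono-≤ (*-monoʳ-≤ c (𝟙-mono {b} (λ _ → level-false⇒true H ly))) (*-monoʳ-≤ a (≤-reflexive (cong 𝟙 (≡.sym ly)))) ⟩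
        c * 𝟙 (levels true s y) + a * 𝟙 (levels false s y)
          ≤⟨ fibre-boundary s yx ⟩
        sum {V H} (λ h → 𝟙 (boundary GH s (combine x h))) ∎

      shadow-boundary : ∀ s → W (dual (weight H ∷ ws)) (𝟙 ∘ shadow s) ≤ size (boundary GH s)
      shadow-boundary s = begin
        W (dual (weight H ∷ ws)) (𝟙 ∘ shadow s)
          ≤⟨ +-mono-≤ (*-monoʳ-≤ c (M.shadow-boundary _)) (*-monoʳ-≤ a (M.shadow-boundary _)) ⟩
        c * size (boundary G (levels true s)) + a * size (boundary G (levels false s))
          ≡⟨ sum-linear {V G} c a (𝟙 ∘ boundary G (levels true s)) (𝟙 ∘ boundary G (levels false s)) ⟨
        sum (λ x → c * 𝟙 (boundary G (levels true s) x) + a * 𝟙 (boundary G (levels false s) x))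
          ≤⟨ sum-mono {V G} (boundary-fibre s) ⟩
        sum {V G} (λ x → sum {V H} (λ h → 𝟙 (boundary GH s (combine x h))))
          ≡⟨ sum-combine (V G) (V H) (𝟙 ∘ boundary GH s) ⟨
        size (boundary GH s) ∎

    product : CubeModel GH (weight H ∷ ws)
    product = record
      { type = type
      ; sum-type = sum-type
      ; type-adj = λ u v uv → let p , q = ∧-true uv in I-opposite _ _ q ∷ M.type-adj _ _ p
      ; shadow = shadow
      ; shadow-mono = λ { h (b ∷ x) → M.shadow-mono (λ v → level-mono H b (λ k → h (combine v k))) x }
      ; shadow-up = shadow-up
      ; shadow-size = shadow-size
      ; shadow-boundary = shadow-boundary
      }

  -- The last factor comes first, so that the factor split off by `prodG` is the coordinate along
  -- which `Nested` cuts.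
  weights : (m : ℕ) → (Fin (suc m) → Graph) → Weights (suc m)
  weights zero    H = weight (H zero) ∷ []
  weights (suc m) H = weight (H (fromℕ (suc m))) ∷ weights m (H ∘ inject₁)

  prodG-model : ∀ m (H : Fin (suc m) → Graph) → (∀ k → CompleteMultipartite (H k)) → CubeModel (prodG m H) (weights m H)
  prodG-model zero    H cm = single (H zero) (cm zero)
  prodG-model (suc m) H cm = product (prodG-model m (H ∘ inject₁) (cm ∘ inject₁)) (cm (fromℕ (suc m)))

open CubeModels
open import Data.Integer as ℤ using (+_)
import Data.Integer.Properties as ℤₚ
open import Data.Rational as ℚ
  using (ℚ; mkℚ; 0ℚ; 1ℚ; _+_; _*_; _-_; -_; _⊓_; _≤ᵇ_; _≤_; _<_; 1/_; Positive; NonNegative;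
         positive; nonNegative; ≢-nonZero; toℚᵘ)
open import Data.Rational.Properties as ℚₚ
open import Data.Rational.Solver using (module +-*-Solver)
open import Data.Rational.Unnormalised as ℚᵘ using (mkℚᵘ; *≡*)
import Data.Rational.Unnormalised.Properties as ℚᵘₚ

-- Dichotomy for subsets of a product

family-up : ∀ {n} (S : Nested n) → IsUp (family S)
family-up S {true ∷ _}  {true ∷ _}  (_ ∷ x⊑y) p = Nested.C-up S x⊑y p
family-up S {false ∷ _} {true ∷ _}  (_ ∷ x⊑y) p = Nested.C-up S x⊑y (Nested.B⇒C S p)
family-up S {false ∷ _} {false ∷ _} (_ ∷ x⊑y) p = Nested.B-up S x⊑y p

unfamily : ∀ {n} (F : Cube (suc n) → Bool) → IsUp F → Nested n
unfamily F up = nested {B = F ∘ (false ∷_)} {C = F ∘ (true ∷_)}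
  (λ x⊑y → up (Bool.b≤b ∷ x⊑y)) (λ x⊑y → up (Bool.b≤b ∷ x⊑y)) (up (Bool.f≤t ∷ ⊑-refl))

∣∂tabulate∣ : ∀ G s → ∣ ∂ G (tabulate s) ∣ ≡ size (boundary G s)
∣∂tabulate∣ G s = ≡.trans (∣tabulate∣≡size (boundary G s′)) (ℕₚ.≤-antisym
  (size-mono {s = boundary G s′} {t = boundary G s}
    (boundary-mono G (λ v p → ≡.trans (≡.sym (Vecₚ.lookup∘tabulate s v)) p)))
  (size-mono {s = boundary G s} {t = boundary G s′}
    (boundary-mono G (λ v p → ≡.trans (Vecₚ.lookup∘tabulate s v) p))))
  where s′ = lookup (tabulate s)

module _ {G H : Graph} {n} {ws : Weights n} (M : CubeModel G ws) (cm : CompleteMultipartite H) where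
  private
    module M = CubeModel M
    module P = CubeModel (product {H = H} M cm)
    a = α H
    c = V H ∸ α H
    GH = G ×G H

    W-empty : ∀ (vs : Weights n) {F : Cube n → Bool} → (∀ x → F x ≡ false) → W vs (𝟙 ∘ F) ≡ 0
    W-empty vs h = ≡.trans (W-cong vs (cong 𝟙 ∘ h)) (W-zero vs)

    W-full : ∀ (vs : Weights n) {F : Cube n → Bool} → (∀ x → F x ≡ true) → W vs (𝟙 ∘ F) ≡ W vs (const 1)
    W-full vs h = W-cong vs (cong 𝟙 ∘ h)

  open ℕₚ.≤-Reasoning

  -- The left alternative compares `S` with `T` placed over the largest part of `H`; the right one
  -- with everything over that part together with `T` over the remaining vertices. These are the two
  -- cases of the recursion in absolute counts.
  Reduct : Subset (V GH) → Subset (V G) → Set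
  Reduct S T =
    (∣ S ∣ ℕ.≤ a ℕ.* ∣ T ∣ × c ℕ.* ∣ ∂ G T ∣ ℕ.≤ ∣ ∂ GH S ∣) ⊎
    (∣ S ∣ ℕ.≤ a ℕ.* V G ℕ.+ c ℕ.* ∣ T ∣ × c ℕ.* V G ℕ.+ a ℕ.* ∣ ∂ G T ∣ ℕ.≤ ∣ ∂ GH S ∣)
  -- `T` realizes the section that compression leaves free: `C` if `B` is empty, `B` if `C` is
  -- everything. Both are up-sets, so realizing them keeps the size and bounds the boundary.
  dichotomy : ShiftCondition a c ws → ∀ S → ∃ (Reduct S)
  dichotomy cond S
    with N , ext , p , q ← compress a c ws cond (unfamily (P.shadow (lookup S)) (P.shadow-up (lookup S)))
    = choose ext
    where
    open Nested N
    ∣S∣≤ : ∣ S ∣ ℕ.≤ a ℕ.* W ws (𝟙 ∘ C) ℕ.+ c ℕ.* W ws (𝟙 ∘ B)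
    ∣S∣≤ = ℕₚ.≤-trans (ℕₚ.≤-reflexive (∣∣≡size S)) (ℕₚ.≤-trans (P.shadow-size (lookup S)) p)
    ≤∣∂S∣ : c ℕ.* W (dual ws) (𝟙 ∘ C) ℕ.+ a ℕ.* W (dual ws) (𝟙 ∘ B) ℕ.≤ ∣ ∂ GH S ∣
    ≤∣∂S∣ = ℕₚ.≤-trans (ℕₚ.≤-trans q (P.shadow-boundary (lookup S)))
                       (ℕₚ.≤-reflexive (≡.sym (∣tabulate∣≡size (boundary GH (lookup S)))))
    realized : ∀ F → W ws (𝟙 ∘ F) ≡ ∣ tabulate (F ∘ M.type) ∣
    realized F = ≡.sym (≡.trans (∣tabulate∣≡size (F ∘ M.type)) (M.realize-size F))
    realized-∂ : ∀ F → IsUp F → ∣ ∂ G (tabulate (F ∘ M.type)) ∣ ℕ.≤ W (dual ws) (𝟙 ∘ F)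
    realized-∂ F up = ℕₚ.≤-trans (ℕₚ.≤-reflexive (∣∂tabulate∣ G (F ∘ M.type))) (M.realize-boundary F up)
    choose : Extreme N → ∃ (Reduct S)
    choose (inj₁ B-empty) = tabulate (C ∘ M.type) , inj₁
      ( (begin
          ∣ S ∣                                            ≤⟨ ∣S∣≤ ⟩
          a ℕ.* W ws (𝟙 ∘ C) ℕ.+ c ℕ.* W ws (𝟙 ∘ B)
            ≡⟨ cong₂ (λ x y → a ℕ.* x ℕ.+ c ℕ.* y) (realized C) (W-empty ws B-empty) ⟩
          a ℕ.* ∣ tabulate (C ∘ M.type) ∣ ℕ.+ c ℕ.* 0      ≡⟨ cong (a ℕ.* ∣ tabulate (C ∘ M.type) ∣ ℕ.+_) (ℕₚ.*-zeroʳ c) ⟩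
          a ℕ.* ∣ tabulate (C ∘ M.type) ∣ ℕ.+ 0            ≡⟨ ℕₚ.+-identityʳ _ ⟩
          a ℕ.* ∣ tabulate (C ∘ M.type) ∣                  ∎)
      , (begin
          c ℕ.* ∣ ∂ G (tabulate (C ∘ M.type)) ∣            ≤⟨ ℕₚ.*-monoʳ-≤ c (realized-∂ C C-up) ⟩
          c ℕ.* W (dual ws) (𝟙 ∘ C)                        ≤⟨ ℕₚ.m≤m+n _ _ ⟩
          c ℕ.* W (dual ws) (𝟙 ∘ C) ℕ.+ a ℕ.* W (dual ws) (𝟙 ∘ B) ≤⟨ ≤∣∂S∣ ⟩
          ∣ ∂ GH S ∣                                       ∎))
    choose (inj₂ C-full) = tabulate (B ∘ M.type) , inj₂
      ( (begin
          ∣ S ∣                                            ≤⟨ ∣S∣≤ ⟩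
          a ℕ.* W ws (𝟙 ∘ C) ℕ.+ c ℕ.* W ws (𝟙 ∘ B)
            ≡⟨ cong₂ (λ x y → a ℕ.* x ℕ.+ c ℕ.* y) (≡.trans (W-full ws C-full) M.W-ones) (realized B) ⟩
          a ℕ.* V G ℕ.+ c ℕ.* ∣ tabulate (B ∘ M.type) ∣    ∎)
      , (begin
          c ℕ.* V G ℕ.+ a ℕ.* ∣ ∂ G (tabulate (B ∘ M.type)) ∣
            ≤⟨ ℕₚ.+-mono-≤ (ℕₚ.*-monoʳ-≤ c (ℕₚ.≤-reflexive (≡.sym (≡.trans (W-full (dual ws) C-full) M.W-dual-ones))))
                           (ℕₚ.*-monoʳ-≤ a (realized-∂ B B-up)) ⟩
          c ℕ.* W (dual ws) (𝟙 ∘ C) ℕ.+ a ℕ.* W (dual ws) (𝟙 ∘ B) ≤⟨ ≤∣∂S∣ ⟩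
          ∣ ∂ GH S ∣                                       ∎))

  private
    extend : (N : Nested n) → ∃ λ (S : Subset (V GH)) →
      ∣ S ∣ ≡ a ℕ.* W ws (𝟙 ∘ Nested.C N) ℕ.+ c ℕ.* W ws (𝟙 ∘ Nested.B N) ×
      ∣ ∂ GH S ∣ ℕ.≤ c ℕ.* W (dual ws) (𝟙 ∘ Nested.C N) ℕ.+ a ℕ.* W (dual ws) (𝟙 ∘ Nested.B N)
    extend N = tabulate (family N ∘ P.type)
      , ≡.trans (∣tabulate∣≡size (family N ∘ P.type)) (P.realize-size (family N))
      , ℕₚ.≤-trans (ℕₚ.≤-reflexive (∣∂tabulate∣ GH (family N ∘ P.type))) (P.realize-boundary (family N) (family-up N))

    size-shadow : ∀ T → ∣ T ∣ ℕ.≤ W ws (𝟙 ∘ M.shadow (lookup T))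
    size-shadow T = ℕₚ.≤-trans (ℕₚ.≤-reflexive (∣∣≡size T)) (M.shadow-size (lookup T))

    shadow-∂ : ∀ T → W (dual ws) (𝟙 ∘ M.shadow (lookup T)) ℕ.≤ ∣ ∂ G T ∣
    shadow-∂ T = ℕₚ.≤-trans (M.shadow-boundary (lookup T))
                            (ℕₚ.≤-reflexive (≡.sym (∣tabulate∣≡size (boundary G (lookup T)))))

  -- `T` is first replaced by its shadow, because `realize-boundary` speaks of up-sets. The shadow
  -- becomes the section `C` over the largest part, and `B` stays empty.
  extend-low : ∀ (T : Subset (V G)) → ∃ λ (S : Subset (V GH)) →
    a ℕ.* ∣ T ∣ ℕ.≤ ∣ S ∣ × ∣ ∂ GH S ∣ ℕ.≤ c ℕ.* ∣ ∂ G T ∣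
  extend-low T with S , p , q ← extend (nested {B = const false} {C = M.shadow (lookup T)}
                                          (λ _ ()) (M.shadow-up (lookup T)) (λ ())) = S
    , (begin
        a ℕ.* ∣ T ∣        ≤⟨ ℕₚ.*-monoʳ-≤ a (size-shadow T) ⟩
        a ℕ.* W ws (𝟙 ∘ M.shadow (lookup T)) ≤⟨ ℕₚ.m≤m+n _ _ ⟩
        a ℕ.* W ws (𝟙 ∘ M.shadow (lookup T)) ℕ.+ c ℕ.* W ws (const 0) ≡⟨ p ⟨
        ∣ S ∣              ∎)
    , (begin
        ∣ ∂ GH S ∣         ≤⟨ q ⟩
        c ℕ.* W (dual ws) (𝟙 ∘ M.shadow (lookup T)) ℕ.+ a ℕ.* W (dual ws) (const 0)
          ≡⟨ cong (λ z → c ℕ.* W (dual ws) (𝟙 ∘ M.shadow (lookup T)) ℕ.+ a ℕ.* z) (W-zero (dual ws)) ⟩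
        c ℕ.* W (dual ws) (𝟙 ∘ M.shadow (lookup T)) ℕ.+ a ℕ.* 0
          ≡⟨ cong (c ℕ.* W (dual ws) (𝟙 ∘ M.shadow (lookup T)) ℕ.+_) (ℕₚ.*-zeroʳ a) ⟩
        c ℕ.* W (dual ws) (𝟙 ∘ M.shadow (lookup T)) ℕ.+ 0  ≡⟨ ℕₚ.+-identityʳ _ ⟩
        c ℕ.* W (dual ws) (𝟙 ∘ M.shadow (lookup T))  ≤⟨ ℕₚ.*-monoʳ-≤ c (shadow-∂ T) ⟩
        c ℕ.* ∣ ∂ G T ∣    ∎)

  -- Here the largest part carries everything, and the shadow of `T` becomes the section `B` over
  -- the rest.
  extend-high : ∀ (T : Subset (V G)) → ∃ λ (S : Subset (V GH)) →
    a ℕ.* V G ℕ.+ c ℕ.* ∣ T ∣ ℕ.≤ ∣ S ∣ × ∣ ∂ GH S ∣ ℕ.≤ c ℕ.* V G ℕ.+ a ℕ.* ∣ ∂ G T ∣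
  extend-high T with S , p , q ← extend (nested {B = M.shadow (lookup T)} {C = const true}
                                           (M.shadow-up (lookup T)) (λ _ _ → refl) (λ _ → refl)) = S
    , (begin
        a ℕ.* V G ℕ.+ c ℕ.* ∣ T ∣
          ≤⟨ ℕₚ.+-mono-≤ (ℕₚ.*-monoʳ-≤ a (ℕₚ.≤-reflexive (≡.sym M.W-ones))) (ℕₚ.*-monoʳ-≤ c (size-shadow T)) ⟩
        a ℕ.* W ws (const 1) ℕ.+ c ℕ.* W ws (𝟙 ∘ M.shadow (lookup T)) ≡⟨ p ⟨
        ∣ S ∣              ∎)
    , (begin
        ∣ ∂ GH S ∣         ≤⟨ q ⟩
        c ℕ.* W (dual ws) (const 1) ℕ.+ a ℕ.* W (dual ws) (𝟙 ∘ M.shadow (lookup T))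
          ≤⟨ ℕₚ.+-mono-≤ (ℕₚ.*-monoʳ-≤ c (ℕₚ.≤-reflexive M.W-dual-ones)) (ℕₚ.*-monoʳ-≤ a (shadow-∂ T)) ⟩
        c ℕ.* V G ℕ.+ a ℕ.* ∣ ∂ G T ∣ ∎)

-- Rationals with a prescribed denominator

<⇒≱ : ∀ {p q} → p < q → ¬ (q ≤ p)
<⇒≱ p<q q≤p = <-irrefl refl (<-≤-trans p<q q≤p)

ι : ℕ → ℚ
ι n = mkℚ (+ n) 0 (Coprimality.sym (Coprimality.1-coprimeTo n))

ι-+ : ∀ m n → ι (m ℕ.+ n) ≡ ι m + ι n
ι-+ m n = toℚᵘ-injective (ℚᵘₚ.≃-trans (*≡* eq) (ℚᵘₚ.≃-sym (toℚᵘ-homo-+ (ι m) (ι n))))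
  where
  eq : + (m ℕ.+ n) ℤ.* + 1 ≡ (+ m ℤ.* + 1 ℤ.+ + n ℤ.* + 1) ℤ.* + 1
  eq rewrite ℤₚ.*-identityʳ (+ m) | ℤₚ.*-identityʳ (+ n) = refl

ι-* : ∀ m n → ι (m ℕ.* n) ≡ ι m * ι n
ι-* m n = toℚᵘ-injective (ℚᵘₚ.≃-trans (*≡* (cong (ℤ._* + 1) (ℤₚ.pos-* m n))) (ℚᵘₚ.≃-sym (toℚᵘ-homo-* (ι m) (ι n))))

ι-mono : ∀ {m n} → m ℕ.≤ n → ι m ≤ ι n
ι-mono {m} {n} m≤n = ℚ.*≤* (ℤₚ.*-monoʳ-≤-nonNeg (+ 1) (ℤ.+≤+ m≤n))

ι-cancel : ∀ {m n} → ι m ≤ ι n → m ℕ.≤ n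
ι-cancel {m} {n} (ℚ.*≤* h) = ℤₚ.drop‿+≤+ (ℤₚ.*-cancelʳ-≤-pos (+ m) (+ n) (+ 1) h)

ι-pos : ∀ n → .{{NonZero n}} → Positive (ι n)
ι-pos (suc n) = _

ι-nonNeg : ∀ n → NonNegative (ι n)
ι-nonNeg n = _

infix 4 _≈[_]_

-- This is `x = k / d` without reduction to lowest terms, so that comparing densities over a common
-- `d` amounts to comparing counts.
record _≈[_]_ (x : ℚ) (d k : ℕ) : Set where
  constructor scaled
  field unscale : x * ι d ≡ ι k

/-≈ : ∀ k d .{{_ : NonZero d}} → (+ k) ℚ./ d ≈[ d ] k
/-≈ k (suc d) = scaled (toℚᵘ-injective (begin
  toℚᵘ ((+ k) ℚ./ suc d * ι (suc d))                ≈⟨ toℚᵘ-homo-* ((+ k) ℚ./ suc d) (ι (suc d)) ⟩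
  toℚᵘ ((+ k) ℚ./ suc d) ℚᵘ.* mkℚᵘ (+ suc d) 0      ≈⟨ ℚᵘₚ.*-congʳ (toℚᵘ-fromℚᵘ (mkℚᵘ (+ k) d)) ⟩
  mkℚᵘ (+ k) d ℚᵘ.* mkℚᵘ (+ suc d) 0                ≈⟨ *≡* (ℤₚ.*-assoc (+ k) (+ suc d) (+ 1)) ⟩
  mkℚᵘ (+ k) 0                                      ∎))
  where open ℚᵘₚ.≃-Reasoning

1≈ : ∀ d → 1ℚ ≈[ d ] d
1≈ d = scaled (*-identityˡ (ι d))

0≈ : ∀ d → 0ℚ ≈[ d ] 0
0≈ d = scaled (*-zeroˡ (ι d))

-- The denominators appear in reverse order so that a fraction over `V H` times a density over `V G`
-- lands on `V G * V H`, the vertex count of `G ×G H`.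
≈-* : ∀ {x y d e k l} → x ≈[ d ] k → y ≈[ e ] l → x * y ≈[ e ℕ.* d ] k ℕ.* l
≈-* {x} {y} {d} {e} {k} {l} (scaled p) (scaled q) = scaled (begin
  x * y * ι (e ℕ.* d)    ≡⟨ cong (x * y *_) (ι-* e d) ⟩
  x * y * (ι e * ι d)    ≡⟨ solve 4 (λ x y d e → x :* y :* (e :* d) := (x :* d) :* (y :* e)) refl x y (ι d) (ι e) ⟩
  (x * ι d) * (y * ι e)  ≡⟨ cong₂ _*_ p q ⟩
  ι k * ι l              ≡⟨ ι-* k l ⟨
  ι (k ℕ.* l)            ∎)
  where
  open ≡.≡-Reasoning
  open +-*-Solver

≈-+ : ∀ {x y d k l} → x ≈[ d ] k → y ≈[ d ] l → x + y ≈[ d ] k ℕ.+ l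
≈-+ {x} {y} {d} {k} {l} (scaled p) (scaled q) = scaled (≡.trans (*-distribʳ-+ (ι d) x y) (≡.trans (cong₂ _+_ p q) (≡.sym (ι-+ k l))))

≈-1- : ∀ {x d k} → k ℕ.≤ d → x ≈[ d ] k → 1ℚ - x ≈[ d ] d ∸ k
≈-1- {x} {d} {k} k≤d (scaled p) = scaled (begin
  (1ℚ - x) * ι d                   ≡⟨ solve 2 (λ x d → (con 1ℚ :- x) :* d := d :- x :* d) refl x (ι d) ⟩
  ι d - x * ι d                    ≡⟨ cong₂ (λ u v → ι u - v) (≡.sym (ℕₚ.m∸n+n≡m k≤d)) p ⟩
  ι (d ∸ k ℕ.+ k) - ι k            ≡⟨ cong (_- ι k) (ι-+ (d ∸ k) k) ⟩
  ι (d ∸ k) + ι k - ι k            ≡⟨ solve 2 (λ u v → u :+ v :- v := u) refl (ι (d ∸ k)) (ι k) ⟩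
  ι (d ∸ k)                        ∎)
  where
  open ≡.≡-Reasoning
  open +-*-Solver

≈-≤ : ∀ {x y d k l} .{{_ : NonZero d}} → x ≈[ d ] k → y ≈[ d ] l → k ℕ.≤ l → x ≤ y
≈-≤ {d = d} (scaled p) (scaled q) k≤l = *-cancelʳ-≤-pos (ι d) {{ι-pos d}} (subst₂ _≤_ (≡.sym p) (≡.sym q) (ι-mono k≤l))

≈-cross : ∀ {x y d e k l} → x ≈[ d ] k → y ≈[ e ] l → x ≤ y → k ℕ.* e ℕ.≤ d ℕ.* l
≈-cross {x} {y} {d} {e} {k} {l} (scaled p) (scaled q) x≤y = ι-cancel (begin
  ι (k ℕ.* e)          ≡⟨ ι-* k e ⟩
  ι k * ι e            ≡⟨ cong (_* ι e) (≡.sym p) ⟩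
  x * ι d * ι e        ≡⟨ *-assoc x (ι d) (ι e) ⟩
  x * (ι d * ι e)      ≡⟨ cong (x *_) (ι-* d e) ⟨
  x * ι (d ℕ.* e)      ≤⟨ *-monoʳ-≤-nonNeg (ι (d ℕ.* e)) {{ι-nonNeg (d ℕ.* e)}} x≤y ⟩
  y * ι (d ℕ.* e)      ≡⟨ cong (y *_) (ι-* d e) ⟩
  y * (ι d * ι e)      ≡⟨ solve 3 (λ y d e → y :* (d :* e) := d :* (y :* e)) refl y (ι d) (ι e) ⟩
  ι d * (y * ι e)      ≡⟨ cong (ι d *_) q ⟩
  ι d * ι l            ≡⟨ ι-* d l ⟨
  ι (d ℕ.* l)          ∎)
  where
  open ℚₚ.≤-Reasoning
  open +-*-Solver

÷'-* : ∀ p q → q ≢ 0ℚ → (p ÷' q) * q ≡ p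
÷'-* p q q≢0 with q ℚₚ.≟ 0ℚ
... | yes q≡0 = contradiction q≡0 q≢0
... | no  q≢0 = ≡.trans (*-assoc p (1/ q) q) (≡.trans (cong (p *_) (*-inverseˡ q)) (*-identityʳ p))
  where instance _ = ≢-nonZero q≢0

÷'-≤ : ∀ {p q r} → 0ℚ < q → p ≤ q * r → p ÷' q ≤ r
÷'-≤ {p} {q} {r} 0<q h = *-cancelʳ-≤-pos q {{positive 0<q}}
  (subst₂ _≤_ (≡.sym (÷'-* p q (<⇒≢ 0<q ∘ ≡.sym))) (*-comm q r) h)

≤-÷' : ∀ {p q r} → 0ℚ < q → p ÷' q ≤ r → p ≤ q * r
≤-÷' {p} {q} {r} 0<q h =
  subst₂ _≤_ (÷'-* p q (<⇒≢ 0<q ∘ ≡.sym)) (*-comm r q)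
    (*-monoʳ-≤-nonNeg q {{nonNegative (<⇒≤ 0<q)}} h)

-- Densities

open _≈[_]_

module _ (G : Graph) where
  private instance _ = nz G

  μ-≈ : ∀ S → μ G S ≈[ V G ] ∣ S ∣
  μ-≈ S = /-≈ ∣ S ∣ (V G)

  β-≈ : β G ≈[ V G ] α G
  β-≈ = /-≈ (α G) (V G)

  1-β-≈ : 1ℚ - β G ≈[ V G ] V G ∸ α G
  1-β-≈ = ≈-1- {β G} (α≤V G) β-≈

  ∣∣≤V : ∀ S → ∣ S ∣ ℕ.≤ V G
  ∣∣≤V S = ℕₚ.≤-trans (ℕₚ.≤-reflexive (∣∣≡size S)) (size-total (lookup S))

  μ≤1 : ∀ S → μ G S ≤ 1ℚ
  μ≤1 S = ≈-≤ (μ-≈ S) (1≈ (V G)) (∣∣≤V S)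

  1≤μ⊤ : 1ℚ ≤ μ G Subset.⊤
  1≤μ⊤ = ≈-≤ (1≈ (V G)) (μ-≈ Subset.⊤) (ℕₚ.≤-reflexive (≡.sym (Subsetₚ.∣⊤∣≡n (V G))))

  0≤μ : ∀ S → 0ℚ ≤ μ G S
  0≤μ S = ≈-≤ (0≈ (V G)) (μ-≈ S) z≤n

  0≤1-β : 0ℚ ≤ 1ℚ - β G
  0≤1-β = ≈-≤ (0≈ (V G)) 1-β-≈ z≤n

  0≤β : 0ℚ ≤ β G
  0≤β = ≈-≤ (0≈ (V G)) β-≈ z≤n

  β≢0 : β G ≢ 0ℚ
  β≢0 eq = ℕₚ.<⇒≱ (α>0 G) (ι-cancel (≤-reflexive (begin
    ι (α G)        ≡⟨ unscale β-≈ ⟨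
    β G * ι (V G)  ≡⟨ cong (_* ι (V G)) eq ⟩
    0ℚ * ι (V G)   ≡⟨ unscale (0≈ (V G)) ⟩
    ι 0            ∎)))
    where open ≡.≡-Reasoning

  0<β : 0ℚ < β G
  0<β = ≰⇒> λ β≤0 → β≢0 (≤-antisym β≤0 0≤β)

  -- Numerator and denominator of the ratio are fractions over `V G`, which cancels.
  ρ-≈ : ρ G ≈[ α G ] V G ∸ α G
  ρ-≈ = scaled (begin
    ρ G * ι (α G)            ≡⟨ cong (ρ G *_) (unscale β-≈) ⟨
    ρ G * (β G * ι (V G))    ≡⟨ *-assoc (ρ G) (β G) (ι (V G)) ⟨
    ρ G * β G * ι (V G)      ≡⟨ cong (_* ι (V G)) (÷'-* (1ℚ - β G) (β G) β≢0) ⟩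
    (1ℚ - β G) * ι (V G)     ≡⟨ unscale 1-β-≈ ⟩
    ι (V G ∸ α G)            ∎)
    where open ≡.≡-Reasoning

-- The profile as an attained minimum

module ConstrainedMin {A : Set} (ν : ℚ) (f g : A → ℚ) where

  -- Repeats the fold step of `Φ` for arbitrary `f` and `g`. With the measures of a set and of its
  -- boundary the two agree by computation, so `Φ` inherits the lemmas below.
  step : A → Maybe ℚ → Maybe ℚ
  step x best = if ν ≤ᵇ f x then just (maybe (λ m → g x ⊓ m) (g x) best) else best

  fold-≤ : ∀ {x} xs → x ∈ xs → ν ≤ f x → ∃ λ m → foldr step nothing xs ≡ just m × m ≤ g x
  fold-≤ (x ∷ xs) (here refl) h rewrite T⇒≡ (≤⇒≤ᵇ h) with foldr step nothing xs
  ... | nothing = _ , refl , ≤-refl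
  ... | just m  = _ , refl , p⊓q≤p _ m
  fold-≤ (y ∷ xs) (there x∈) h with fold-≤ xs x∈ h
  ... | m , eq , m≤ with ν ≤ᵇ f y
  ... | false = m , eq , m≤
  ... | true rewrite eq = _ , refl , ≤-trans (p⊓q≤q (g y) m) m≤

  fold-attained : ∀ xs {m} → foldr step nothing xs ≡ just m → ∃ λ x → ν ≤ f x × m ≡ g x
  fold-attained (x ∷ xs) eq with ν ≤ᵇ f x in h
  ... | false = fold-attained xs eq
  ... | true with foldr step nothing xs in eq′
  ... | nothing = x , ≤ᵇ⇒≤ (≡⇒T h) , ≡.sym (just-injective eq)
  ... | just k with ⊓-sel (g x) k
  ... | inj₁ p = x , ≤ᵇ⇒≤ (≡⇒T h) , ≡.trans (≡.sym (just-injective eq)) p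
  ... | inj₂ p with y , νy , k≡ ← fold-attained xs eq′ = y , νy , ≡.trans (≡.sym (just-injective eq)) (≡.trans p k≡)

  min-or-1 : List A → ℚ
  min-or-1 xs = maybe (λ m → m) 1ℚ (foldr step nothing xs)

  min-≤ : ∀ {x} xs → x ∈ xs → ν ≤ f x → min-or-1 xs ≤ g x
  min-≤ xs x∈ h with m , eq , m≤ ← fold-≤ xs x∈ h rewrite eq = m≤

  min-attained : ∀ {x} xs → x ∈ xs → ν ≤ f x → ∃ λ y → ν ≤ f y × min-or-1 xs ≡ g y
  min-attained xs x∈ h with m , eq , _ ← fold-≤ xs x∈ h
    with y , νy , p ← fold-attained xs eq rewrite eq = y , νy , p

Φ-≤ : ∀ G ν S → ν ≤ μ G S → Φ G ν ≤ μ G (∂ G S)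
Φ-≤ G ν S = ConstrainedMin.min-≤ ν (μ G) (λ R → μ G (∂ G R)) (allSubsets (V G)) (∈-allSubsets S)

-- For `ν` at most 1 the full vertex set is feasible, so the default value of `Φ` is never reached.
Φ-attained : ∀ G ν → ν ≤ 1ℚ → ∃ λ S → ν ≤ μ G S × Φ G ν ≡ μ G (∂ G S)
Φ-attained G ν ν≤1 = ConstrainedMin.min-attained ν (μ G) (λ R → μ G (∂ G R))
  (allSubsets (V G)) (∈-allSubsets Subset.⊤) (≤-trans ν≤1 (1≤μ⊤ G))

Φ-zero : ∀ G {ν} → ν ≡ 0ℚ → Φ G ν ≡ 0ℚ
Φ-zero G {ν} ν≡0 = ≤-antisym
  (≤-trans (Φ-≤ G ν ∅ (≤-trans (≤-reflexive ν≡0) (0≤μ G ∅)))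
    (≈-≤ (μ-≈ G (∂ G ∅)) (0≈ (V G)) (ℕₚ.≤-trans (ℕₚ.≤-reflexive (∣∂tabulate∣ G (const false))) ∂∅-empty)))
  (let S , _ , eq = Φ-attained G ν (≤-trans (≤-reflexive ν≡0) (≈-≤ (0≈ 1) (1≈ 1) z≤n))
   in ≤-trans (0≤μ G (∂ G S)) (≤-reflexive (≡.sym eq)))
  where
  instance _ = nz G
  ∅ : Subset (V G)
  ∅ = tabulate (const false)
  none : ∀ w → boundary G (const false) w ≡ true → false ≡ true
  none w b with boundary-elim G (const false) w b
  ... | _ , () , _
  ∂∅-empty : size (boundary G (const false)) ℕ.≤ 0
  ∂∅-empty = ℕₚ.≤-trans (size-mono none) (ℕₚ.≤-reflexive (size-none {V G}))

-- The two claims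

module _ (H : Graph) (cm : CompleteMultipartite H) where
  open Factor H cm
  open CubeModel (single H cm) using (realize-size; realize-boundary)

  ∂-nonempty : ∀ S → 0 ℕ.< ∣ S ∣ → V H ∸ α H ℕ.≤ ∣ ∂ H S ∣
  ∂-nonempty S 0<∣S∣ = begin
    c                                                          ≤⟨ bound ⟩
    c ℕ.* 𝟙 (level H true s) ℕ.+ a ℕ.* 𝟙 (level H false s)     ≤⟨ level-boundary s ⟩
    size (boundary H s)                                        ≡⟨ ∣tabulate∣≡size (boundary H s) ⟨
    ∣ ∂ H S ∣                                                  ∎
    where
    open ℕₚ.≤-Reasoning
    s = lookup S
    bound : c ℕ.≤ c ℕ.* 𝟙 (level H true s) ℕ.+ a ℕ.* 𝟙 (level H false s)
    bound with level H true s in l₁ | level H false s in l₀ | level-size s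
    ... | true  | _     | _ = ℕₚ.≤-trans (ℕₚ.≤-reflexive (≡.sym (ℕₚ.*-identityʳ c))) (ℕₚ.m≤m+n _ _)
    ... | false | true  | _ = contradiction (≡.trans (≡.sym l₁) (level-false⇒true H {s} l₀)) false≢true
    ... | false | false | h rewrite ℕₚ.*-zeroʳ a | ℕₚ.*-zeroʳ c =
      contradiction (ℕₚ.≤-trans (ℕₚ.≤-trans 0<∣S∣ (ℕₚ.≤-reflexive (∣∣≡size S))) h) λ ()

  -- By `level-size` a set without an edge has at most `α H` vertices. So `S` contains an edge, and
  -- `level-boundary` yields all of `V H`.
  ∂-large : ∀ S → α H ℕ.< ∣ S ∣ → V H ℕ.≤ ∣ ∂ H S ∣
  ∂-large S α<∣S∣ = begin
    V H                                                        ≡⟨ a+c ⟨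
    a ℕ.+ c                                                    ≤⟨ bound ⟩
    c ℕ.* 𝟙 (level H true s) ℕ.+ a ℕ.* 𝟙 (level H false s)     ≤⟨ level-boundary s ⟩
    size (boundary H s)                                        ≡⟨ ∣tabulate∣≡size (boundary H s) ⟨
    ∣ ∂ H S ∣                                                  ∎
    where
    open ℕₚ.≤-Reasoning
    s = lookup S
    bound : a ℕ.+ c ℕ.≤ c ℕ.* 𝟙 (level H true s) ℕ.+ a ℕ.* 𝟙 (level H false s)
    bound with level H true s in l₁ | level H false s in l₀ | level-size s
    ... | true  | true  | _ rewrite ℕₚ.*-identityʳ a | ℕₚ.*-identityʳ c = ℕₚ.≤-reflexive (ℕₚ.+-comm a c)
    ... | false | true  | _ = contradiction (≡.trans (≡.sym l₁) (level-false⇒true H {s} l₀)) false≢true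
    ... | l     | false | h = contradiction α<∣S∣ (ℕₚ.≤⇒≯ (ℕₚ.≤-trans (ℕₚ.≤-reflexive (∣∣≡size S)) (ℕₚ.≤-trans h small)))
      where
      small : a ℕ.* 𝟙 l ℕ.+ c ℕ.* 0 ℕ.≤ a
      small rewrite ℕₚ.*-zeroʳ c | ℕₚ.+-identityʳ (a ℕ.* 𝟙 l) =
        ℕₚ.≤-trans (ℕₚ.*-monoʳ-≤ a (𝟙-mono {l} {true} λ _ → refl)) (ℕₚ.≤-reflexive (ℕₚ.*-identityʳ a))

  -- `I` is the up-set `Vec.head` of the one-dimensional cube pulled back along `type`, so the
  -- realization lemmas apply to it.
  largest-part : ∃ λ (S : Subset (V H)) → ∣ S ∣ ≡ α H × ∣ ∂ H S ∣ ℕ.≤ V H ∸ α H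
  largest-part = tabulate I
    , ≡.trans (∣tabulate∣≡size I) (≡.trans (realize-size Vec.head) left)
    , ℕₚ.≤-trans (ℕₚ.≤-reflexive (∣∂tabulate∣ H I)) (ℕₚ.≤-trans (realize-boundary Vec.head head-up) (ℕₚ.≤-reflexive right))
    where
    head-up : IsUp {1} Vec.head
    head-up (Bool.b≤b ∷ []) p = p
    head-up (Bool.f≤t ∷ []) p = refl
    left : a ℕ.* 1 ℕ.+ c ℕ.* 0 ≡ a
    left rewrite ℕₚ.*-zeroʳ c | ℕₚ.+-identityʳ (a ℕ.* 1) = ℕₚ.*-identityʳ a
    right : c ℕ.* 1 ℕ.+ a ℕ.* 0 ≡ c
    right rewrite ℕₚ.*-zeroʳ a | ℕₚ.+-identityʳ (c ℕ.* 1) = ℕₚ.*-identityʳ c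

firstClaim : ∀ H → CompleteMultipartite H → FirstClaim H
firstClaim H cm ν 0≤ν ν≤1 = Φ-zero H , low , high
  where
  instance _ = nz H

  low : 0ℚ < ν → ν ≤ β H → Φ H ν ≡ 1ℚ - β H
  low 0<ν ν≤β =
    let S , νS , eq = Φ-attained H ν ν≤1
        R , ∣R∣ , ∣∂R∣ = largest-part H cm
    in ≤-antisym
    (≤-trans (Φ-≤ H ν R (≤-trans ν≤β (≈-≤ (β-≈ H) (μ-≈ H R) (ℕₚ.≤-reflexive (≡.sym ∣R∣)))))
             (≈-≤ (μ-≈ H (∂ H R)) (1-β-≈ H) ∣∂R∣))
    (≤-trans (≈-≤ (1-β-≈ H) (μ-≈ H (∂ H S)) (∂-nonempty H cm S (ℕₚ.≰⇒> (S-nonempty S νS)))) (≤-reflexive (≡.sym eq)))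
    where
    S-nonempty : ∀ S → ν ≤ μ H S → ¬ (∣ S ∣ ℕ.≤ 0)
    S-nonempty S νS h = <⇒≱ 0<ν (≤-trans νS (≈-≤ (μ-≈ H S) (0≈ (V H)) h))

  high : β H < ν → Φ H ν ≡ 1ℚ
  high β<ν =
    let S , νS , eq = Φ-attained H ν ν≤1
    in ≤-antisym
    (≤-trans (≤-reflexive eq) (μ≤1 H (∂ H S)))
    (≤-trans (≈-≤ (1≈ (V H)) (μ-≈ H (∂ H S)) (∂-large H cm S (ℕₚ.≰⇒> (S-large S νS)))) (≤-reflexive (≡.sym eq)))
    where
    S-large : ∀ S → ν ≤ μ H S → ¬ (∣ S ∣ ℕ.≤ α H)
    S-large S νS h = <⇒≱ β<ν (≤-trans νS (≈-≤ (μ-≈ H S) (β-≈ H) h))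

-- The cube lists the factors from last to first.
rev : ∀ {n} → Cube n → Subset n
rev []      = []
rev (b ∷ A) = rev A ∷ʳ b

rev-nonempty : ∀ {n} (A : Cube n) → A ≢ replicate n false → Nonempty (rev A)
rev-nonempty []          h = contradiction refl h
rev-nonempty (true ∷ A)  h = last-in (rev A)
  where
  last-in : ∀ {n} (S : Subset n) → Nonempty (S ∷ʳ true)
  last-in []      = zero , Vec.here
  last-in (b ∷ S) with i , i∈ ← last-in S = suc i , Vec.there i∈
rev-nonempty (false ∷ A) h = init-in (rev A) (rev-nonempty A (h ∘ cong (false ∷_)))
  where
  init-in : ∀ {n} (S : Subset n) → Nonempty S → Nonempty (S ∷ʳ false)
  init-in (b ∷ S) (zero  , Vec.here)     = zero , Vec.here
  init-in (b ∷ S) (suc i , Vec.there i∈) with j , j∈ ← init-in S (i , i∈) = suc j , Vec.there j∈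

-- Products of ratios as fractions of cube weights

infixr 7 _·[_]_

-- One step of the fold in `prodOver`, made an operator so that steps at different indices can be
-- commuted.
_·[_]_ : ℚ → Bool → ℚ → ℚ
x ·[ b ] y = if b then x * y else y

·-swap : ∀ b c x y z → x ·[ b ] (y ·[ c ] z) ≡ y ·[ c ] (x ·[ b ] z)
·-swap false c     x y z = refl
·-swap true  false x y z = refl
·-swap true  true  x y z = solve 3 (λ x y z → x :* (y :* z) := y :* (x :* z)) refl x y z
  where open +-*-Solver

prodOver-∷ : ∀ {n} b (A : Subset n) (f : Fin (suc n) → ℚ) →
  prodOver (b ∷ A) f ≡ f zero ·[ b ] prodOver A (f ∘ suc)
prodOver-∷ {n} b A f = cong (f zero ·[ b ]_) (≡.trans
  (cong (foldr factor 1ℚ) (≡.sym (Listₚ.map-tabulate {n = n} (λ k → k) suc)))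
  (Listₚ.foldr-map factor suc 1ℚ (allFin n)))
  where
  factor : Fin (suc n) → ℚ → ℚ
  factor k y = f k ·[ lookup (b ∷ A) k ] y

-- The fold meets the last index innermost, while the cube lists that factor first; `·-swap` carries
-- it outward past the others.
prodOver-∷ʳ : ∀ {n} (A : Subset n) b (f : Fin (suc n) → ℚ) →
  prodOver (A ∷ʳ b) f ≡ f (fromℕ n) ·[ b ] prodOver A (f ∘ inject₁)
prodOver-∷ʳ []      b f = refl
prodOver-∷ʳ (a ∷ A) b f = begin
  prodOver (a ∷ (A ∷ʳ b)) f
    ≡⟨ prodOver-∷ a (A ∷ʳ b) f ⟩
  f zero ·[ a ] prodOver (A ∷ʳ b) (f ∘ suc)
    ≡⟨ cong (f zero ·[ a ]_) (prodOver-∷ʳ A b (f ∘ suc)) ⟩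
  f zero ·[ a ] (f (fromℕ _) ·[ b ] prodOver A (f ∘ suc ∘ inject₁))
    ≡⟨ ·-swap a b (f zero) (f (fromℕ _)) (prodOver A (f ∘ suc ∘ inject₁)) ⟩
  f (fromℕ _) ·[ b ] (f zero ·[ a ] prodOver A (f ∘ suc ∘ inject₁))
    ≡⟨ cong (f (fromℕ _) ·[ b ]_) (prodOver-∷ a A (f ∘ inject₁)) ⟨
  f (fromℕ _) ·[ b ] prodOver (a ∷ A) (f ∘ inject₁) ∎
  where open ≡.≡-Reasoning

ρ-·-≈ : ∀ H b {n} {ws : Weights n} {A y} → y ≈[ ∏₁ ws A ] ∏₀ ws A →
        (ρ H ·[ b ] y) ≈[ ∏₁ (weight H ∷ ws) (b ∷ A) ] ∏₀ (weight H ∷ ws) (b ∷ A)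
ρ-·-≈ H false                   h = h
ρ-·-≈ H true  {ws = ws} {A} {y} h =
  subst (λ d → ρ H * y ≈[ d ] (V H ∸ α H) ℕ.* ∏₀ ws A) (ℕₚ.*-comm (∏₁ ws A) (α H)) (≈-* (ρ-≈ H) h)

-- By `ρ-≈` each chosen factor puts the weight of its 0 in the numerator and the weight of its 1 in
-- the denominator.
prodOver-≈ : ∀ m (H : Fin (suc m) → Graph) A →
  prodOver (rev A) (ρ ∘ H) ≈[ ∏₁ (weights m H) A ] ∏₀ (weights m H) A
prodOver-≈ zero    H (b ∷ []) = ρ-·-≈ (H zero) b {ws = []} {[]} (1≈ 1)
prodOver-≈ (suc m) H (b ∷ A) =
  subst (_≈[ ∏₁ (weights (suc m) H) (b ∷ A) ] ∏₀ (weights (suc m) H) (b ∷ A))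
    (≡.sym (prodOver-∷ʳ (rev A) b (ρ ∘ H)))
    (ρ-·-≈ (H (fromℕ (suc m))) b {ws = weights m (H ∘ inject₁)} {A} (prodOver-≈ m (H ∘ inject₁) A))

-- The recursion for the profile

module _ {G H : Graph} {n} {ws : Weights n} (M : CubeModel G ws) (cm : CompleteMultipartite H)
         (cond : ShiftCondition (α H) (V H ∸ α H) ws) where
  private
    instance
      _ = nz G
      _ = nz H
      _ = nz (G ×G H)
    GH = G ×G H
    b  = β H

    μ-low : ∀ T {x k} → x ≈[ V H ] k → x * μ G T ≈[ V GH ] k ℕ.* ∣ T ∣
    μ-low T p = ≈-* p (μ-≈ G T)

    μ-high : ∀ T {x y k l} → x ≈[ V H ] k → y ≈[ V H ] l → x + y * μ G T ≈[ V GH ] k ℕ.* V G ℕ.+ l ℕ.* ∣ T ∣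
    μ-high T {x} p q = ≈-+ (subst (_≈[ V GH ] _) (*-identityʳ x) (≈-* p (1≈ (V G)))) (μ-low T q)

    Φ′≤1 : ∀ ν → ν ≤ 1ℚ → Φ G ν ≤ 1ℚ
    Φ′≤1 ν ν≤1 = let S , _ , eq = Φ-attained G ν ν≤1 in ≤-trans (≤-reflexive eq) (μ≤1 G (∂ G S))

    mono-β : ∀ {x y} → x ≤ y → b * x ≤ b * y
    mono-β = *-monoˡ-≤-nonNeg b {{nonNegative (0≤β H)}}

    mono-1-β : ∀ {x y} → x ≤ y → (1ℚ - b) * x ≤ (1ℚ - b) * y
    mono-1-β = *-monoˡ-≤-nonNeg (1ℚ - b) {{nonNegative (0≤1-β H)}}

    Reductμ : Subset (V GH) → Subset (V G) → Set
    Reductμ S T =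
      (μ GH S ≤ b * μ G T × (1ℚ - b) * μ G (∂ G T) ≤ μ GH (∂ GH S)) ⊎
      (μ GH S ≤ b + (1ℚ - b) * μ G T × (1ℚ - b) + b * μ G (∂ G T) ≤ μ GH (∂ GH S))

    rescale : ∀ S T → Reduct {H = H} M cm S T → Reductμ S T
    rescale S T (inj₁ (p , q)) = inj₁
      (≈-≤ (μ-≈ GH S) (μ-low T (β-≈ H)) p , ≈-≤ (μ-low (∂ G T) (1-β-≈ H)) (μ-≈ GH (∂ GH S)) q)
    rescale S T (inj₂ (p , q)) = inj₂
      (≈-≤ (μ-≈ GH S) (μ-high T (β-≈ H) (1-β-≈ H)) p , ≈-≤ (μ-high (∂ G T) (1-β-≈ H) (β-≈ H)) (μ-≈ GH (∂ GH S)) q)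

    dichotomy-μ : ∀ S → ∃ (Reductμ S)
    dichotomy-μ S = let T , red = dichotomy {H = H} M cm cond S in T , rescale S T red

  Φ-low : ∀ ν → ν ≤ 1ℚ → 0ℚ < ν → ν ≤ b → Φ GH ν ≡ (1ℚ - b) * Φ G (ν ÷' b)
  Φ-low ν ν≤1 0<ν ν≤b = ≤-antisym upper lower
    where
    ν′ = ν ÷' b
    ν′≤1 : ν′ ≤ 1ℚ
    ν′≤1 = ÷'-≤ (0<β H) (≤-trans ν≤b (≤-reflexive (≡.sym (*-identityʳ b))))

    upper : Φ GH ν ≤ (1ℚ - b) * Φ G ν′
    upper =
      let T , νT , eq = Φ-attained G ν′ ν′≤1
          S , p , q   = extend-low {H = H} M cm T
      in begin
      Φ GH ν                   ≤⟨ Φ-≤ GH ν S (≤-trans (≤-÷' (0<β H) νT) (≈-≤ (μ-low T (β-≈ H)) (μ-≈ GH S) p)) ⟩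
      μ GH (∂ GH S)            ≤⟨ ≈-≤ (μ-≈ GH (∂ GH S)) (μ-low (∂ G T) (1-β-≈ H)) q ⟩
      (1ℚ - b) * μ G (∂ G T)   ≡⟨ cong ((1ℚ - b) *_) eq ⟨
      (1ℚ - b) * Φ G ν′        ∎
      where open ℚₚ.≤-Reasoning

    bound : ∀ S T → ν ≤ μ GH S → Reductμ S T → (1ℚ - b) * Φ G ν′ ≤ μ GH (∂ GH S)
    bound S T νS (inj₁ (p , q)) = begin
      (1ℚ - b) * Φ G ν′        ≤⟨ mono-1-β (Φ-≤ G ν′ T (÷'-≤ (0<β H) (≤-trans νS p))) ⟩
      (1ℚ - b) * μ G (∂ G T)   ≤⟨ q ⟩
      μ GH (∂ GH S)            ∎
      where open ℚₚ.≤-Reasoning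
    -- In this alternative the boundary has measure at least `1ℚ - b`, which suffices because the
    -- profile of `G` is at most 1 at `ν′`.
    bound S T νS (inj₂ (p , q)) = begin
      (1ℚ - b) * Φ G ν′        ≤⟨ mono-1-β (Φ′≤1 ν′ ν′≤1) ⟩
      (1ℚ - b) * 1ℚ            ≡⟨ *-identityʳ (1ℚ - b) ⟩
      1ℚ - b                   ≡⟨ +-identityʳ (1ℚ - b) ⟨
      (1ℚ - b) + 0ℚ            ≡⟨ cong (λ z → (1ℚ - b) + z) (*-zeroʳ b) ⟨
      (1ℚ - b) + b * 0ℚ        ≤⟨ +-monoʳ-≤ (1ℚ - b) (mono-β (0≤μ G (∂ G T))) ⟩
      (1ℚ - b) + b * μ G (∂ G T) ≤⟨ q ⟩
      μ GH (∂ GH S)            ∎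
      where open ℚₚ.≤-Reasoning

    lower : (1ℚ - b) * Φ G ν′ ≤ Φ GH ν
    lower =
      let S , νS , eq = Φ-attained GH ν ν≤1
          T , red     = dichotomy-μ S
      in ≤-trans (bound S T νS red) (≤-reflexive (≡.sym eq))

  Φ-high : ∀ ν → ν ≤ 1ℚ → b < ν → Φ GH ν ≡ (1ℚ - b) + b * Φ G ((ν - b) ÷' (1ℚ - b))
  Φ-high ν ν≤1 b<ν = ≤-antisym upper lower
    where
    ν′ = (ν - b) ÷' (1ℚ - b)

    cancel : ∀ x y → x + y - x ≡ y
    cancel = solve 2 (λ x y → x :+ y :- x := y) refl
      where open +-*-Solver

    restore : ∀ x y → x + (y - x) ≡ y
    restore = solve 2 (λ x y → x :+ (y :- x) := y) refl
      where open +-*-Solver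

    0<1-b : 0ℚ < 1ℚ - b
    -- From `b < ν` and `ν ≤ 1` the divisor is kept away from 0, where `÷'` would return its
    -- default.
    0<1-b = subst (_< 1ℚ - b) (+-inverseʳ b) (+-monoˡ-< (- b) (<-≤-trans b<ν ν≤1))

    ν′≤ : ∀ {x} → ν ≤ b + (1ℚ - b) * x → ν′ ≤ x
    ν′≤ {x} h = ÷'-≤ 0<1-b (subst (ν - b ≤_) (cancel b ((1ℚ - b) * x)) (+-monoˡ-≤ (- b) h))

    ≤ν′ : ∀ {x} → ν′ ≤ x → ν ≤ b + (1ℚ - b) * x
    ≤ν′ {x} h = subst (_≤ b + (1ℚ - b) * x) (restore b ν) (+-monoʳ-≤ b (≤-÷' 0<1-b h))

    ν′≤1 : ν′ ≤ 1ℚ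
    ν′≤1 = ν′≤ (≤-trans ν≤1 (≤-reflexive (≡.sym (≡.trans (cong (λ z → b + z) (*-identityʳ (1ℚ - b))) (restore b 1ℚ)))))

    upper : Φ GH ν ≤ (1ℚ - b) + b * Φ G ν′
    upper =
      let T , νT , eq = Φ-attained G ν′ ν′≤1
          S , p , q   = extend-high {H = H} M cm T
      in begin
      Φ GH ν                     ≤⟨ Φ-≤ GH ν S (≤-trans (≤ν′ νT) (≈-≤ (μ-high T (β-≈ H) (1-β-≈ H)) (μ-≈ GH S) p)) ⟩
      μ GH (∂ GH S)              ≤⟨ ≈-≤ (μ-≈ GH (∂ GH S)) (μ-high (∂ G T) (1-β-≈ H) (β-≈ H)) q ⟩
      (1ℚ - b) + b * μ G (∂ G T) ≡⟨ cong (λ z → (1ℚ - b) + b * z) eq ⟨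
      (1ℚ - b) + b * Φ G ν′      ∎
      where open ℚₚ.≤-Reasoning

    bound : ∀ S T → ν ≤ μ GH S → Reductμ S T → (1ℚ - b) + b * Φ G ν′ ≤ μ GH (∂ GH S)
    -- This alternative would give `S` measure at most `b`, which is below `ν`.
    bound S T νS (inj₁ (p , q)) = contradiction
      (≤-trans (≤-trans νS p) (≤-trans (mono-β (μ≤1 G T)) (≤-reflexive (*-identityʳ b)))) (<⇒≱ b<ν)
    bound S T νS (inj₂ (p , q)) = begin
      (1ℚ - b) + b * Φ G ν′      ≤⟨ +-monoʳ-≤ (1ℚ - b) (mono-β (Φ-≤ G ν′ T (ν′≤ (≤-trans νS p)))) ⟩
      (1ℚ - b) + b * μ G (∂ G T) ≤⟨ q ⟩
      μ GH (∂ GH S)              ∎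
      where open ℚₚ.≤-Reasoning

    lower : (1ℚ - b) + b * Φ G ν′ ≤ Φ GH ν
    lower =
      let S , νS , eq = Φ-attained GH ν ν≤1
          T , red     = dichotomy-μ S
      in ≤-trans (bound S T νS red) (≤-reflexive (≡.sym eq))

theorem1p5 : (m : ℕ) (H : Fin (suc m) → Graph) →
    (∀ k → CompleteMultipartite (H k)) →
    (∀ i j → i Fin.≤ j → β (H i) ≤ β (H j)) →
    (∀ (A : Subset m) → Nonempty A →
    ρ (H (fromℕ m)) ≤ prodOver A (λ k → ρ (H (inject₁ k)))) →
    FirstClaim (H Fin.zero) × SecondClaim m H
theorem1p5 zero    H cm _ _    = firstClaim (H zero) (cm zero) , tt
theorem1p5 (suc m) H cm _ cond = firstClaim (H zero) (cm zero) , λ ν _ ν≤1 →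
  Φ-zero (prodG (suc m) H) , Φ-low {H = Hₙ} M (cm (fromℕ (suc m))) shifts ν ν≤1 , Φ-high {H = Hₙ} M (cm (fromℕ (suc m))) shifts ν ν≤1
  where
  Hₙ = H (fromℕ (suc m))
  H′ = H ∘ inject₁
  M = prodG-model m H′ (cm ∘ inject₁)
  shifts : ShiftCondition (α Hₙ) (V Hₙ ∸ α Hₙ) (weights m H′)
  -- The hypothesis lists the factors from first to last, so it is used at `rev A`;
  -- cross-multiplying its two fractions gives the inequality for `A`.
  shifts A A≢∅ = ≈-cross (ρ-≈ Hₙ) (prodOver-≈ m H′ A) (cond (rev A) (rev-nonempty A A≢∅))
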